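{- We have $$\frac{(1-t)(1+t\exp_{q}(x))}{1-t^{2}\exp_{q}(x)\mathrm{Exp}_{q}(yx)}=1+t(1+yt)\sum_{n=1}^{\infty}\frac{(1+yt^{2})^{n-1}}{(1-t^{2})^{n}}\,P_{n}^{(\mathrm{inv},\mathrm{lpk},\mathrm{val},\mathrm{des})}\left(q,\alpha,\beta,\gamma\right)\frac{x^{n}}{[n]_{q}!},$$ where $$\alpha=\frac{t(1+y)(y+t)}{(y+t^{2})(1+yt)},\qquad \beta=\frac{t(1+y)(1+yt)}{(1+yt^{2})(y+t)},\qquad \gamma=\frac{y+t^{2}}{1+yt^{2}}.$$
   Context: $\mathfrak{S}_n$ is the set of permutations $\pi=\pi_1\cdots\pi_n$ of $[n]=\{1,\dots,n\}$. For $\pi\in\mathfrak{S}_n$: $\mathrm{des}(\pi)$ is the number of $i\in[n-1]$ with $\pi_i>\pi_{i+1}$; $\mathrm{lpk}(\pi)$ is the number of left peaks, where $i\in[n-1]$ is a left peak if either $2\le i\le n-1$ and $\pi_{i-1}<\pi_i>\pi_{i+1}$, or $i=1$ and $\pi_1>\pi_2$; $\mathrm{val}(\pi)$ is the number of valleys, i.e. of $i$ with $2\le i\le n-1$ and $\pi_{i-1}>\pi_i<\pi_{i+1}$; $\mathrm{inv}(\pi)$ is the number of pairs $(i,j)$ with $1\le i<j\le n$ and $\pi_i>\pi_j$. For $n\ge1$, $P_n^{(\mathrm{inv},\mathrm{lpk},\mathrm{val},\mathrm{des})}(q,y,z,t)=\sum_{\pi\in\mathfrak{S}_n}q^{\mathrm{inv}(\pi)}y^{\mathrm{lpk}(\pi)}z^{\mathrm{val}(\pi)}t^{\mathrm{des}(\pi)}$.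 Also $[n]_q!=(1+q)(1+q+q^2)\cdots(1+q+\cdots+q^{n-1})$ (with $[0]_q!=[1]_q!=1$), $\exp_q(x)=\sum_{n\ge0}\frac{x^n}{[n]_q!}$ and $\mathrm{Exp}_q(x)=\sum_{n\ge0}q^{\binom n2}\frac{x^n}{[n]_q!}$. Here $q,y,t,x$ are indeterminates and the identity is one of formal power series in $x$ whose coefficients are rational functions of $q,y,t$. -}

module Defs where

open import Algebra.Bundles using (CommutativeRing; RawRing)
open import Algebra.Core using (Op₁; Op₂)
open import Algebra.Morphism.Structures using (IsRingMonomorphism)
import Algebra.Morphism.RingMonomorphism as RingMonomorphism
import Algebra.Properties.CommutativeSemigroup as CommutativeSemigroupProperties
import Algebra.Properties.Monoid.Sum as MonoidSum
import Algebra.Properties.Ring as RingProperties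
import Algebra.Properties.Semiring.Exp as SemiringExp
import Algebra.Solver.Ring.NaturalCoefficients.Default as SemiringSolver
open import Data.Fin.Base as Fin using (toℕ)
import Data.Integer.Properties as ℤ
open import Data.List.Base
  using (List; []; _∷_; map; foldr; filter; length; cartesianProductWith; applyUpTo)
open import Data.List.Relation.Unary.Unique.DecPropositional using (unique?)
open import Data.Nat.Base as ℕ using (ℕ; zero; suc; _∸_)
open import Data.Nat.Combinatorics using (_C_)
import Data.Nat.Properties as ℕ
open import Data.Product.Base using (_,_)
open import Data.Sum.Base using (_⊎_; inj₁; inj₂)
open import Data.Vec.Base as Vec using (Vec; []; _∷_)
open import Function.Base using (_∘_)
open import Level using (Level; _⊔_; 0ℓ) renaming (suc to lsuc)
open import Relation.Binary.Core using (Rel)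
open import Relation.Binary.Definitions using (Decidable)
open import Relation.Binary.PropositionalEquality.Core as ≡ using (_≡_)
import Relation.Binary.Reasoning.Setoid as SetoidReasoning
open import Relation.Nullary.Decidable.Core using (Dec; yes; no; _×-dec_; map′)
open import Relation.Nullary.Negation.Core using (¬_; contradiction)

private variable
  c ℓ : Level

record DecIntegralDomain c ℓ : Set (lsuc (c ⊔ ℓ)) where
  field
    commutativeRing : CommutativeRing c ℓ
  open CommutativeRing commutativeRing public
  infix 4 _≟_
  field
    _≟_             : Decidable _≈_
    1≉0             : ¬ (1# ≈ 0#)
    noZeroDivisors  : ∀ x y → x * y ≈ 0# → x ≈ 0# ⊎ y ≈ 0#

-- Inversion is total; 0⁻¹ = 0 is a junk value.
record DecField c ℓ : Set (lsuc (c ⊔ ℓ)) where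
  field
    commutativeRing : CommutativeRing c ℓ
  open CommutativeRing commutativeRing public
  infix  4 _≟_
  infix  9 _⁻¹
  infixl 7 _/_
  field
    _≟_             : Decidable _≈_
    1≉0             : ¬ (1# ≈ 0#)
    _⁻¹             : Op₁ Carrier
    ⁻¹-cong         : ∀ {x y} → x ≈ y → x ⁻¹ ≈ y ⁻¹
    ⁻¹-inverseʳ     : ∀ x → ¬ (x ≈ 0#) → x * x ⁻¹ ≈ 1#
    0⁻¹≈0           : 0# ⁻¹ ≈ 0#

  _/_ : Op₂ Carrier
  x / y = x * y ⁻¹

module PowerSeries (R : CommutativeRing c ℓ) where
  open CommutativeRing R
  open MonoidSum +-monoid using (sum; sum⁺-syntax)
  open CommutativeSemigroupProperties +-commutativeSemigroup using (interchange)
  open SetoidReasoning setoid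

  Series : Set c
  Series = ℕ → Carrier

  infix  4 _≈ₛ_
  infixl 6 _+ₛ_ _-ₛ_
  infixl 7 _*ₛ_
  infix  8 -ₛ_

  _≈ₛ_ : Rel Series ℓ
  f ≈ₛ g = ∀ n → f n ≈ g n

  const : Carrier → Series
  const a zero    = a
  const a (suc n) = 0#

  0ₛ 1ₛ : Series
  0ₛ n = 0#
  1ₛ = const 1#

  _+ₛ_ _*ₛ_ : Op₂ Series
  (f +ₛ g) n = f n + g n
  (f *ₛ g) n = ∑[ i ≤ n ] (f (toℕ i) * g (n ∸ toℕ i))

  -ₛ_ : Op₁ Series
  (-ₛ f) n = - f n

  _-ₛ_ : Op₂ Series
  f -ₛ g = f +ₛ -ₛ g

  shift : Series → Series
  shift f n = f (suc n)

  *ₛ-cong : ∀ {f f′ g g′} → f ≈ₛ f′ → g ≈ₛ g′ → f *ₛ g ≈ₛ f′ *ₛ g′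
  *ₛ-cong p q zero    = +-congʳ (*-cong (p 0) (q 0))
  *ₛ-cong p q (suc n) = +-cong (*-cong (p 0) (q (suc n))) (*ₛ-cong (p ∘ suc) q n)

  *ₛ-zeroˡ : ∀ g → 0ₛ *ₛ g ≈ₛ 0ₛ
  *ₛ-zeroˡ g zero    = trans (+-congʳ (zeroˡ _)) (+-identityˡ 0#)
  *ₛ-zeroˡ g (suc n) = trans (+-cong (zeroˡ _) (*ₛ-zeroˡ g n)) (+-identityˡ 0#)

  *ₛ-identityˡ : ∀ g → 1ₛ *ₛ g ≈ₛ g
  *ₛ-identityˡ g zero    = trans (+-identityʳ _) (*-identityˡ _)
  *ₛ-identityˡ g (suc n) =
    trans (+-cong (*-identityˡ _) (*ₛ-zeroˡ g n)) (+-identityʳ _)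

  *ₛ-expandʳ : ∀ f g n → (f *ₛ g) (suc n) ≈ f (suc n) * g 0 + (f *ₛ shift g) n
  *ₛ-expandʳ f g zero = begin
    f 0 * g 1 + (f 1 * g 0 + 0#)   ≈⟨ +-congˡ (+-identityʳ _) ⟩
    f 0 * g 1 + f 1 * g 0          ≈⟨ +-comm _ _ ⟩
    f 1 * g 0 + f 0 * g 1          ≈⟨ +-congˡ (+-identityʳ _) ⟨
    f 1 * g 0 + (f 0 * g 1 + 0#)   ∎
  *ₛ-expandʳ f g (suc n) = begin
    a + (shift f *ₛ g) (suc n)     ≈⟨ +-congˡ (*ₛ-expandʳ (shift f) g n) ⟩
    a + (b + d)                    ≈⟨ +-assoc a b d ⟨
    (a + b) + d                    ≈⟨ +-congʳ (+-comm a b) ⟩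
    (b + a) + d                    ≈⟨ +-assoc b a d ⟩
    b + (a + d)                    ∎
    where
    a = f 0 * g (suc (suc n))
    b = f (suc (suc n)) * g 0
    d = (shift f *ₛ shift g) n

  *ₛ-comm : ∀ f g → f *ₛ g ≈ₛ g *ₛ f
  *ₛ-comm f g zero    = +-congʳ (*-comm _ _)
  *ₛ-comm f g (suc n) = begin
    f 0 * g (suc n) + (shift f *ₛ g) n ≈⟨ +-cong (*-comm _ _) (*ₛ-comm (shift f) g n) ⟩
    g (suc n) * f 0 + (g *ₛ shift f) n ≈⟨ *ₛ-expandʳ g f n ⟨
    (g *ₛ f) (suc n)                   ∎

  *ₛ-distribʳ : ∀ h f g → (f +ₛ g) *ₛ h ≈ₛ f *ₛ h +ₛ g *ₛ h
  *ₛ-distribʳ h f g zero = begin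
    (f 0 + g 0) * h 0 + 0#                   ≈⟨ +-identityʳ _ ⟩
    (f 0 + g 0) * h 0                        ≈⟨ distribʳ _ _ _ ⟩
    f 0 * h 0 + g 0 * h 0                    ≈⟨ +-cong (+-identityʳ _) (+-identityʳ _) ⟨
    (f 0 * h 0 + 0#) + (g 0 * h 0 + 0#)      ∎
  *ₛ-distribʳ h f g (suc n) = begin
    (f 0 + g 0) * h (suc n) + ((shift f +ₛ shift g) *ₛ h) n
      ≈⟨ +-cong (distribʳ _ _ _) (*ₛ-distribʳ h (shift f) (shift g) n) ⟩
    (f 0 * h (suc n) + g 0 * h (suc n)) + ((shift f *ₛ h) n + (shift g *ₛ h) n)
      ≈⟨ interchange _ _ _ _ ⟩
    (f *ₛ h +ₛ g *ₛ h) (suc n) ∎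

  *ₛ-scaleˡ : ∀ a f g n → ((λ m → a * f m) *ₛ g) n ≈ a * (f *ₛ g) n
  *ₛ-scaleˡ a f g zero = begin
    a * f 0 * g 0 + 0#      ≈⟨ +-identityʳ _ ⟩
    a * f 0 * g 0           ≈⟨ *-assoc _ _ _ ⟩
    a * (f 0 * g 0)         ≈⟨ *-congˡ (+-identityʳ _) ⟨
    a * (f 0 * g 0 + 0#)    ∎
  *ₛ-scaleˡ a f g (suc n) = begin
    a * f 0 * g (suc n) + ((λ m → a * shift f m) *ₛ g) n
      ≈⟨ +-cong (*-assoc _ _ _) (*ₛ-scaleˡ a (shift f) g n) ⟩
    a * (f 0 * g (suc n)) + a * (shift f *ₛ g) n
      ≈⟨ distribˡ _ _ _ ⟨
    a * (f *ₛ g) (suc n) ∎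

  *ₛ-assoc : ∀ f g h → (f *ₛ g) *ₛ h ≈ₛ f *ₛ (g *ₛ h)
  *ₛ-assoc f g h zero = +-congʳ (begin
    (f 0 * g 0 + 0#) * h 0  ≈⟨ *-congʳ (+-identityʳ _) ⟩
    f 0 * g 0 * h 0         ≈⟨ *-assoc _ _ _ ⟩
    f 0 * (g 0 * h 0)       ≈⟨ *-congˡ (+-identityʳ _) ⟨
    f 0 * (g 0 * h 0 + 0#)  ∎)
  *ₛ-assoc f g h (suc n) = begin
    (f 0 * g 0 + 0#) * h (suc n) + (((λ m → f 0 * shift g m) +ₛ shift f *ₛ g) *ₛ h) n
      ≈⟨ +-cong (trans (*-congʳ (+-identityʳ _)) (*-assoc _ _ _))
                (*ₛ-distribʳ h (λ m → f 0 * shift g m) (shift f *ₛ g) n) ⟩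
    f 0 * (g 0 * h (suc n)) + (((λ m → f 0 * shift g m) *ₛ h) n + ((shift f *ₛ g) *ₛ h) n)
      ≈⟨ +-congˡ (+-cong (*ₛ-scaleˡ (f 0) (shift g) h n) (*ₛ-assoc (shift f) g h n)) ⟩
    f 0 * (g 0 * h (suc n)) + (f 0 * (shift g *ₛ h) n + (shift f *ₛ (g *ₛ h)) n)
      ≈⟨ +-assoc _ _ _ ⟨
    f 0 * (g 0 * h (suc n)) + f 0 * (shift g *ₛ h) n + (shift f *ₛ (g *ₛ h)) n
      ≈⟨ +-congʳ (distribˡ _ _ _) ⟨
    (f *ₛ (g *ₛ h)) (suc n) ∎

  seriesRing : CommutativeRing c ℓ
  seriesRing = record
    { Carrier = Series
    ; _≈_     = _≈ₛ_
    ; _+_     = _+ₛ_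
    ; _*_     = _*ₛ_
    ; -_      = -ₛ_
    ; 0#      = 0ₛ
    ; 1#      = 1ₛ
    ; isCommutativeRing = record
      { isRing = record
        { +-isAbelianGroup = record
          { isGroup = record
            { isMonoid = record
              { isSemigroup = record
                { isMagma = record
                  { isEquivalence = record
                    { refl  = λ n → refl
                    ; sym   = λ p n → sym (p n)
                    ; trans = λ p q n → trans (p n) (q n)
                    }
                  ; ∙-cong = λ p q n → +-cong (p n) (q n)
                  }
                ; assoc = λ f g h n → +-assoc _ _ _
                }
              ; identity = (λ f n → +-identityˡ _) , (λ f n → +-identityʳ _)
              }
            ; inverse = (λ f n → -‿inverseˡ _) , (λ f n → -‿inverseʳ _)
            ; ⁻¹-cong = λ p n → -‿cong (p n)
            }
          ; comm = λ f g n → +-comm _ _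
          }
        ; *-cong     = *ₛ-cong
        ; *-assoc    = *ₛ-assoc
        ; *-identity = *ₛ-identityˡ
                     , λ f n → trans (*ₛ-comm f 1ₛ n) (*ₛ-identityˡ f n)
        ; distrib    = (λ h f g n → trans (*ₛ-comm h (f +ₛ g) n)
                         (trans (*ₛ-distribʳ h f g n)
                                (+-cong (*ₛ-comm f h n) (*ₛ-comm g h n))))
                     , *ₛ-distribʳ
        }
      ; *-comm = *ₛ-comm
      }
    }

  -- f(x) ↦ f(ax)
  rescale : Carrier → Series → Series
  rescale a f n = a ^ n * f n
    where open SemiringExp semiring using (_^_)

  -- Σ_{n≥1} a n xⁿ
  ∑≥1 : (ℕ → Carrier) → Series
  ∑≥1 a zero    = 0#
  ∑≥1 a (suc n) = a (suc n)

module SeriesDivision (K : DecField c ℓ) where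
  open DecField K
  open PowerSeries commutativeRing public
  open MonoidSum +-monoid using (sum; sum-syntax; sum-cong-≗)
  open RingProperties ring using (-‿distribʳ-*)
  open SetoidReasoning setoid

  mutual
    -- The coefficients b₀, …, bₙ₋₁ of 1/f, in the order bₙ₋₁, …, b₀.
    invCoeffs : Series → ∀ n → Vec Carrier n
    invCoeffs f zero    = []
    invCoeffs f (suc n) = invCoeff f n (invCoeffs f n) ∷ invCoeffs f n

    -- b₀ = a₀⁻¹ and bₙ = - a₀⁻¹ Σ_{k=1}^{n} aₖ bₙ₋ₖ.
    invCoeff : Series → ∀ n → Vec Carrier n → Carrier
    invCoeff f zero    _  = f 0 ⁻¹
    invCoeff f (suc n) bs =
      - (f 0 ⁻¹ * ∑[ i < suc n ] (f (suc (toℕ i)) * Vec.lookup bs i))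

  infix  9 _⁻¹ₛ
  infixl 7 _/ₛ_

  -- A multiplicative inverse when f 0 ≉ 0# (see ⁻¹ₛ-inverseʳ); junk otherwise.
  _⁻¹ₛ : Op₁ Series
  (f ⁻¹ₛ) n = Vec.head (invCoeffs f (suc n))

  _/ₛ_ : Op₂ Series
  f /ₛ g = f *ₛ g ⁻¹ₛ

  lookup-invCoeffs : ∀ f n (i : Fin.Fin (suc n)) →
                     Vec.lookup (invCoeffs f (suc n)) i ≡ (f ⁻¹ₛ) (n ∸ toℕ i)
  lookup-invCoeffs f n       Fin.zero    = ≡.refl
  lookup-invCoeffs f (suc n) (Fin.suc i) = lookup-invCoeffs f n i

  ⁻¹ₛ-inverseʳ : ∀ f → ¬ (f 0 ≈ 0#) → f *ₛ f ⁻¹ₛ ≈ₛ 1ₛ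
  ⁻¹ₛ-inverseʳ f f₀≉0 zero    = trans (+-identityʳ _) (⁻¹-inverseʳ (f 0) f₀≉0)
  ⁻¹ₛ-inverseʳ f f₀≉0 (suc n) = begin
    f 0 * - (f 0 ⁻¹ * S) + (shift f *ₛ f ⁻¹ₛ) n
      ≈⟨ +-cong (-‿distribʳ-* _ _)
                (reflexive (sum-cong-≗ {suc n} λ i →
                  ≡.cong (f (suc (toℕ i)) *_) (lookup-invCoeffs f n i))) ⟨
    - (f 0 * (f 0 ⁻¹ * S)) + S
      ≈⟨ +-congʳ (-‿cong (begin
           f 0 * (f 0 ⁻¹ * S)  ≈⟨ *-assoc _ _ _ ⟨
           f 0 * f 0 ⁻¹ * S    ≈⟨ *-congʳ (⁻¹-inverseʳ (f 0) f₀≉0) ⟩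
           1# * S              ≈⟨ *-identityˡ S ⟩
           S                   ∎)) ⟩
    - S + S
      ≈⟨ -‿inverseˡ S ⟩
    0# ∎
    where S = ∑[ i < suc n ] (f (suc (toℕ i)) * Vec.lookup (invCoeffs f (suc n)) i)

module Polynomial (D : DecIntegralDomain c ℓ) where
  open DecIntegralDomain D
  open PowerSeries commutativeRing
  private module S = CommutativeRing seriesRing
  open RingProperties ring using (-0#≈0#)
  open SetoidReasoning setoid

  -- Coefficients in order of increasing degree; trailing zeros are allowed.
  Poly : Set c
  Poly = List Carrier

  coeff : Poly → Series
  coeff []      n       = 0#
  coeff (a ∷ p) zero    = a
  coeff (a ∷ p) (suc n) = coeff p n

  infix  4 _≈ₚ_ _≟ₚ_
  infixl 6 _+ₚ_
  infixl 7 _*ₚ_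

  _≈ₚ_ : Rel Poly ℓ
  p ≈ₚ q = coeff p ≈ₛ coeff q

  _+ₚ_ _*ₚ_ : Op₂ Poly
  []      +ₚ q       = q
  (a ∷ p) +ₚ []      = a ∷ p
  (a ∷ p) +ₚ (b ∷ q) = a + b ∷ (p +ₚ q)

  []      *ₚ q = []
  (a ∷ p) *ₚ q = map (a *_) q +ₚ (0# ∷ (p *ₚ q))

  -ₚ_ : Op₁ Poly
  -ₚ_ = map (-_)

  constₚ : Carrier → Poly
  constₚ a = a ∷ []

  var : Poly
  var = 0# ∷ 1# ∷ []

  coeff-+ : ∀ p q → coeff (p +ₚ q) ≈ₛ coeff p +ₛ coeff q
  coeff-+ []      q       n       = sym (+-identityˡ _)
  coeff-+ (a ∷ p) []      n       = sym (+-identityʳ _)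
  coeff-+ (a ∷ p) (b ∷ q) zero    = refl
  coeff-+ (a ∷ p) (b ∷ q) (suc n) = coeff-+ p q n

  coeff-scale : ∀ a p n → coeff (map (a *_) p) n ≈ a * coeff p n
  coeff-scale a []      n       = sym (zeroʳ a)
  coeff-scale a (b ∷ p) zero    = refl
  coeff-scale a (b ∷ p) (suc n) = coeff-scale a p n

  coeff-neg : ∀ p → coeff (-ₚ p) ≈ₛ -ₛ coeff p
  coeff-neg []      n       = sym -0#≈0#
  coeff-neg (a ∷ p) zero    = refl
  coeff-neg (a ∷ p) (suc n) = coeff-neg p n

  coeff-* : ∀ p q → coeff (p *ₚ q) ≈ₛ coeff p *ₛ coeff q
  coeff-* []      q n       = sym (*ₛ-zeroˡ (coeff q) n)
  coeff-* (a ∷ p) q zero    =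
    trans (coeff-+ (map (a *_) q) (0# ∷ (p *ₚ q)) 0) (+-congʳ (coeff-scale a q 0))
  coeff-* (a ∷ p) q (suc n) =
    trans (coeff-+ (map (a *_) q) (0# ∷ (p *ₚ q)) (suc n))
          (+-cong (coeff-scale a q (suc n)) (coeff-* p q n))

  coeff-1 : coeff (constₚ 1#) ≈ₛ 1ₛ
  coeff-1 zero    = refl
  coeff-1 (suc n) = refl

  polyRawRing : RawRing c ℓ
  polyRawRing = record
    { Carrier = Poly
    ; _≈_     = _≈ₚ_
    ; _+_     = _+ₚ_
    ; _*_     = _*ₚ_
    ; -_      = -ₚ_
    ; 0#      = []
    ; 1#      = constₚ 1#
    }

  coeff-isRingMonomorphism : IsRingMonomorphism polyRawRing S.rawRing coeff
  coeff-isRingMonomorphism = record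
    { isRingHomomorphism = record
      { isSemiringHomomorphism = record
        { isNearSemiringHomomorphism = record
          { +-isMonoidHomomorphism = record
            { isMagmaHomomorphism = record
              { isRelHomomorphism = record { cong = λ p → p }
              ; homo = coeff-+
              }
            ; ε-homo = λ n → refl
            }
          ; *-homo = coeff-*
          }
        ; 1#-homo = coeff-1
        }
      ; -‿homo = coeff-neg
      }
    ; injective = λ p → p
    }

  polyRing : CommutativeRing c ℓ
  polyRing = record
    { RawRing polyRawRing
    ; isCommutativeRing =
        RingMonomorphism.isCommutativeRing coeff-isRingMonomorphism S.isCommutativeRing
    }

  ∷-≈ : ∀ {a b p q} → a ≈ b → p ≈ₚ q → a ∷ p ≈ₚ b ∷ q
  ∷-≈ a≈b p≈q zero    = a≈b
  ∷-≈ a≈b p≈q (suc n) = p≈q n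

  ≟[] : ∀ p → Dec (p ≈ₚ [])
  ≟[] []      = yes λ n → refl
  ≟[] (a ∷ p) = map′ (λ { (h , t) → λ { zero → h ; (suc n) → t n } })
                     (λ h → h 0 , h ∘ suc)
                     ((a ≟ 0#) ×-dec ≟[] p)

  _≟ₚ_ : Decidable _≈ₚ_
  []      ≟ₚ q       = map′ (λ h → sym ∘ h) (λ h → sym ∘ h) (≟[] q)
  (a ∷ p) ≟ₚ []      = ≟[] (a ∷ p)
  (a ∷ p) ≟ₚ (b ∷ q) = map′ (λ { (h , t) → ∷-≈ h t })
                            (λ h → h 0 , h ∘ suc)
                            ((a ≟ b) ×-dec (p ≟ₚ q))

  ∷-regular : ∀ a p → ¬ (a ≈ 0#) → ∀ q → (a ∷ p) *ₚ q ≈ₚ [] → q ≈ₚ []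
  ∷-regular a p a≉0 []      _ = λ n → refl
  ∷-regular a p a≉0 (b ∷ q) z = λ { zero → b≈0 ; (suc n) → ∷-regular a p a≉0 q apq≈0 n }
    where
    b≈0 : b ≈ 0#
    b≈0 with noZeroDivisors a b (trans (sym (+-identityʳ _)) (z 0))
    ... | inj₁ a≈0 = contradiction a≈0 a≉0
    ... | inj₂ b≈0 = b≈0
    apq≈0 : (a ∷ p) *ₚ q ≈ₚ []
    apq≈0 n = begin
      coeff ((a ∷ p) *ₚ q) n
        ≈⟨ coeff-* (a ∷ p) q n ⟩
      (coeff (a ∷ p) *ₛ coeff q) n
        ≈⟨ +-identityˡ _ ⟨
      0# + (coeff (a ∷ p) *ₛ coeff q) n
        ≈⟨ +-congʳ (trans (*-congˡ b≈0) (zeroʳ _)) ⟨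
      coeff (a ∷ p) (suc n) * b + (coeff (a ∷ p) *ₛ coeff q) n
        ≈⟨ *ₛ-expandʳ (coeff (a ∷ p)) (coeff (b ∷ q)) n ⟨
      (coeff (a ∷ p) *ₛ coeff (b ∷ q)) (suc n)
        ≈⟨ coeff-* (a ∷ p) (b ∷ q) (suc n) ⟨
      coeff ((a ∷ p) *ₚ (b ∷ q)) (suc n)
        ≈⟨ z (suc n) ⟩
      0# ∎

  *ₚ-tail : ∀ a p q → a ≈ 0# → (a ∷ p) *ₚ q ≈ₚ [] → p *ₚ q ≈ₚ []
  *ₚ-tail a p q a≈0 z n = begin
    coeff (p *ₚ q) n
      ≈⟨ coeff-* p q n ⟩
    (coeff p *ₛ coeff q) n
      ≈⟨ +-identityˡ _ ⟨
    0# + (coeff p *ₛ coeff q) n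
      ≈⟨ +-congʳ (trans (*-congʳ a≈0) (zeroˡ _)) ⟨
    (coeff (a ∷ p) *ₛ coeff q) (suc n)
      ≈⟨ coeff-* (a ∷ p) q (suc n) ⟨
    coeff ((a ∷ p) *ₚ q) (suc n)
      ≈⟨ z (suc n) ⟩
    0# ∎

  noZeroDivisorsₚ : ∀ p q → p *ₚ q ≈ₚ [] → p ≈ₚ [] ⊎ q ≈ₚ []
  noZeroDivisorsₚ []      q _ = inj₁ λ n → refl
  noZeroDivisorsₚ (a ∷ p) q z with a ≟ 0#
  ... | no a≉0  = inj₂ (∷-regular a p a≉0 q z)
  ... | yes a≈0 with noZeroDivisorsₚ p q (*ₚ-tail a p q a≈0 z)
  ...   | inj₁ p≈0 = inj₁ λ { zero → a≈0 ; (suc n) → p≈0 n }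
  ...   | inj₂ q≈0 = inj₂ q≈0

  polyDomain : DecIntegralDomain c ℓ
  polyDomain = record
    { commutativeRing = polyRing
    ; _≟_             = _≟ₚ_
    ; 1≉0             = λ h → 1≉0 (h 0)
    ; noZeroDivisors  = noZeroDivisorsₚ
    }

module FieldOfFractions (D : DecIntegralDomain c ℓ) where
  open DecIntegralDomain D
  open SetoidReasoning setoid
  open RingProperties ring using (-‿distribˡ-*; -‿distribʳ-*; x∙y⁻¹≈ε⇒x≈y)
  open SemiringSolver commutativeSemiring using (solve; _:+_; _:*_; _:=_)

  infixl 7 _÷_[_]
  record Fraction : Set (c ⊔ ℓ) where
    constructor _÷_[_]
    field
      num   : Carrier
      den   : Carrier
      den≉0 : ¬ (den ≈ 0#)
  open Fraction public

  *-≉0 : ∀ {x y} → ¬ (x ≈ 0#) → ¬ (y ≈ 0#) → ¬ (x * y ≈ 0#)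
  *-≉0 {x} {y} x≉0 y≉0 xy≈0 with noZeroDivisors x y xy≈0
  ... | inj₁ x≈0 = x≉0 x≈0
  ... | inj₂ y≈0 = y≉0 y≈0

  *-cancelʳ : ∀ {x y} z → ¬ (z ≈ 0#) → x * z ≈ y * z → x ≈ y
  *-cancelʳ {x} {y} z z≉0 xz≈yz with noZeroDivisors (x + - y) z (begin
      (x + - y) * z      ≈⟨ distribʳ z x (- y) ⟩
      x * z + - y * z    ≈⟨ +-cong xz≈yz (sym (-‿distribˡ-* y z)) ⟩
      y * z + - (y * z)  ≈⟨ -‿inverseʳ (y * z) ⟩
      0#                 ∎)
  ... | inj₁ x-y≈0 = x∙y⁻¹≈ε⇒x≈y x y x-y≈0
  ... | inj₂ z≈0   = contradiction z≈0 z≉0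

  infix  4 _≈F_ _≟F_
  infixl 6 _+F_
  infixl 7 _*F_

  _≈F_ : Rel Fraction ℓ
  x ≈F y = num x * den y ≈ num y * den x

  ι : Carrier → Fraction
  ι a = a ÷ 1# [ 1≉0 ]

  _+F_ _*F_ : Op₂ Fraction
  (a ÷ b [ b≉0 ]) +F (e ÷ d [ d≉0 ]) = (a * d + e * b) ÷ (b * d) [ *-≉0 b≉0 d≉0 ]
  (a ÷ b [ b≉0 ]) *F (e ÷ d [ d≉0 ]) = (a * e) ÷ (b * d) [ *-≉0 b≉0 d≉0 ]

  -F_ : Op₁ Fraction
  -F (a ÷ b [ b≉0 ]) = (- a) ÷ b [ b≉0 ]

  _⁻¹F : Op₁ Fraction
  (a ÷ b [ b≉0 ]) ⁻¹F with a ≟ 0#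
  ... | yes _  = ι 0#
  ... | no a≉0 = b ÷ a [ a≉0 ]

  _≟F_ : Decidable _≈F_
  x ≟F y = num x * den y ≟ num y * den x

  ≈F-trans : ∀ {x y z} → x ≈F y → y ≈F z → x ≈F z
  ≈F-trans {a ÷ b [ _ ]} {e ÷ d [ d≉0 ]} {g ÷ h [ _ ]} p q = *-cancelʳ d d≉0 (begin
    a * h * d  ≈⟨ solve 3 (λ a h d → a :* h :* d := a :* d :* h) refl a h d ⟩
    a * d * h  ≈⟨ *-congʳ p ⟩
    e * b * h  ≈⟨ solve 3 (λ e b h → e :* b :* h := e :* h :* b) refl e b h ⟩
    e * h * b  ≈⟨ *-congʳ q ⟩
    g * d * b  ≈⟨ solve 3 (λ g d b → g :* d :* b := g :* b :* d) refl g d b ⟩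
    g * b * d  ∎)

  +F-cong : ∀ {x x′ y y′} → x ≈F x′ → y ≈F y′ → x +F y ≈F x′ +F y′
  +F-cong {a ÷ b [ _ ]} {a′ ÷ b′ [ _ ]} {e ÷ d [ _ ]} {e′ ÷ d′ [ _ ]} p q = begin
    (a * d + e * b) * (b′ * d′)
      ≈⟨ solve 6 (λ a b e d b′ d′ → (a :* d :+ e :* b) :* (b′ :* d′)
            := (a :* b′) :* (d :* d′) :+ (e :* d′) :* (b :* b′)) refl a b e d b′ d′ ⟩
    a * b′ * (d * d′) + e * d′ * (b * b′)
      ≈⟨ +-cong (*-congʳ p) (*-congʳ q) ⟩
    a′ * b * (d * d′) + e′ * d * (b * b′)
      ≈⟨ solve 6 (λ a′ b e′ d b′ d′ → (a′ :* b) :* (d :* d′) :+ (e′ :* d) :* (b :* b′)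
            := (a′ :* d′ :+ e′ :* b′) :* (b :* d)) refl a′ b e′ d b′ d′ ⟩
    (a′ * d′ + e′ * b′) * (b * d) ∎

  *F-cong : ∀ {x x′ y y′} → x ≈F x′ → y ≈F y′ → x *F y ≈F x′ *F y′
  *F-cong {a ÷ b [ _ ]} {a′ ÷ b′ [ _ ]} {e ÷ d [ _ ]} {e′ ÷ d′ [ _ ]} p q = begin
    a * e * (b′ * d′)
      ≈⟨ solve 4 (λ a e b′ d′ → a :* e :* (b′ :* d′) := (a :* b′) :* (e :* d′)) refl a e b′ d′ ⟩
    a * b′ * (e * d′)
      ≈⟨ *-cong p q ⟩
    a′ * b * (e′ * d)
      ≈⟨ solve 4 (λ a e b′ d′ → (a :* b′) :* (e :* d′) := a :* e :* (b′ :* d′)) refl a′ e′ b d ⟩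
    a′ * e′ * (b * d) ∎

  -F-cong : ∀ {x y} → x ≈F y → -F x ≈F -F y
  -F-cong {a ÷ b [ _ ]} {e ÷ d [ _ ]} p = begin
    - a * d    ≈⟨ -‿distribˡ-* a d ⟨
    - (a * d)  ≈⟨ -‿cong p ⟩
    - (e * b)  ≈⟨ -‿distribˡ-* e b ⟩
    - e * b    ∎

  +F-comm : ∀ x y → x +F y ≈F y +F x
  +F-comm (a ÷ b [ _ ]) (e ÷ d [ _ ]) = *-cong (+-comm _ _) (*-comm _ _)

  *F-comm : ∀ x y → x *F y ≈F y *F x
  *F-comm (a ÷ b [ _ ]) (e ÷ d [ _ ]) = *-cong (*-comm _ _) (*-comm _ _)

  +F-identityˡ : ∀ x → ι 0# +F x ≈F x
  +F-identityˡ (a ÷ b [ _ ]) =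
    trans (*-congʳ (trans (+-cong (zeroˡ b) (*-identityʳ a)) (+-identityˡ a)))
          (*-congˡ (sym (*-identityˡ b)))

  *F-identityˡ : ∀ x → ι 1# *F x ≈F x
  *F-identityˡ (a ÷ b [ _ ]) = *-cong (*-identityˡ a) (sym (*-identityˡ b))

  -F-inverseˡ : ∀ x → (-F x) +F x ≈F ι 0#
  -F-inverseˡ (a ÷ b [ _ ]) = begin
    (- a * b + a * b) * 1#  ≈⟨ *-congʳ (distribʳ b (- a) a) ⟨
    (- a + a) * b * 1#      ≈⟨ *-congʳ (trans (*-congʳ (-‿inverseˡ a)) (zeroˡ b)) ⟩
    0# * 1#                 ≈⟨ zeroˡ 1# ⟩
    0#                      ≈⟨ zeroˡ _ ⟨
    0# * (b * b)            ∎

  +F-assoc : ∀ x y z → (x +F y) +F z ≈F x +F (y +F z)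
  +F-assoc (a ÷ b [ _ ]) (e ÷ d [ _ ]) (g ÷ h [ _ ]) =
    solve 6 (λ a b e d g h →
      ((a :* d :+ e :* b) :* h :+ g :* (b :* d)) :* (b :* (d :* h))
      := (a :* (d :* h) :+ (e :* h :+ g :* d) :* b) :* (b :* d :* h)) refl a b e d g h

  *F-assoc : ∀ x y z → (x *F y) *F z ≈F x *F (y *F z)
  *F-assoc (a ÷ b [ _ ]) (e ÷ d [ _ ]) (g ÷ h [ _ ]) =
    *-cong (*-assoc a e g) (sym (*-assoc b d h))

  *F-distribʳ : ∀ x y z → (y +F z) *F x ≈F (y *F x) +F (z *F x)
  *F-distribʳ (a ÷ b [ _ ]) (e ÷ d [ _ ]) (g ÷ h [ _ ]) =
    solve 6 (λ a b e d g h →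
      ((e :* h :+ g :* d) :* a) :* ((d :* b) :* (h :* b))
      := ((e :* a) :* (h :* b) :+ (g :* a) :* (d :* b)) :* ((d :* h) :* b)) refl a b e d g h

  fractionRing : CommutativeRing (c ⊔ ℓ) ℓ
  fractionRing = record
    { Carrier = Fraction
    ; _≈_     = _≈F_
    ; _+_     = _+F_
    ; _*_     = _*F_
    ; -_      = -F_
    ; 0#      = ι 0#
    ; 1#      = ι 1#
    ; isCommutativeRing = record
      { isRing = record
        { +-isAbelianGroup = record
          { isGroup = record
            { isMonoid = record
              { isSemigroup = record
                { isMagma = record
                  { isEquivalence = record
                    { refl  = refl
                    ; sym   = sym
                    ; trans = λ {x y z} → ≈F-trans {x} {y} {z}
                    }
                  ; ∙-cong = λ {x y u v} → +F-cong {x} {y} {u} {v}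
                  }
                ; assoc = +F-assoc
                }
              ; identity = +F-identityˡ
                         , λ x → ≈F-trans {x +F ι 0#} {ι 0# +F x} {x}
                                   (+F-comm x (ι 0#)) (+F-identityˡ x)
              }
            ; inverse = -F-inverseˡ
                      , λ x → ≈F-trans {x +F (-F x)} {(-F x) +F x} {ι 0#}
                                (+F-comm x (-F x)) (-F-inverseˡ x)
            ; ⁻¹-cong = λ {x y} → -F-cong {x} {y}
            }
          ; comm = +F-comm
          }
        ; *-cong     = λ {x y u v} → *F-cong {x} {y} {u} {v}
        ; *-assoc    = *F-assoc
        ; *-identity = *F-identityˡ
                     , λ x → ≈F-trans {x *F ι 1#} {ι 1# *F x} {x}
                               (*F-comm x (ι 1#)) (*F-identityˡ x)
        ; distrib    = (λ x y z →
                          ≈F-trans {x *F (y +F z)} {(y +F z) *F x} {(x *F y) +F (x *F z)}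
                            (*F-comm x (y +F z))
                            (≈F-trans {(y +F z) *F x} {(y *F x) +F (z *F x)}
                                      {(x *F y) +F (x *F z)}
                              (*F-distribʳ x y z)
                              (+F-cong {y *F x} {x *F y} {z *F x} {x *F z}
                                (*F-comm y x) (*F-comm z x))))
                     , *F-distribʳ
        }
      ; *-comm = *F-comm
      }
    }

  num≈0 : ∀ x → x ≈F ι 0# → num x ≈ 0#
  num≈0 x p = trans (sym (*-identityʳ _)) (trans p (zeroˡ _))

  num≉0 : ∀ x → ¬ (x ≈F ι 0#) → ¬ (num x ≈ 0#)
  num≉0 x p a≈0 = p (trans (*-identityʳ _) (trans a≈0 (sym (zeroˡ _))))

  ⁻¹F-cong : ∀ {x y} → x ≈F y → x ⁻¹F ≈F y ⁻¹F
  ⁻¹F-cong {a ÷ b [ b≉0 ]} {e ÷ d [ d≉0 ]} p with a ≟ 0# | e ≟ 0#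
  ... | yes _   | yes _   = refl
  ... | yes a≈0 | no e≉0  =
        contradiction (trans (sym p) (trans (*-congʳ a≈0) (zeroˡ d))) (*-≉0 e≉0 b≉0)
  ... | no a≉0  | yes e≈0 =
        contradiction (trans p (trans (*-congʳ e≈0) (zeroˡ b))) (*-≉0 a≉0 d≉0)
  ... | no _    | no _    =
        trans (*-comm b e) (trans (sym p) (*-comm a d))

  ⁻¹F-inverseʳ : ∀ x → ¬ (x ≈F ι 0#) → x *F x ⁻¹F ≈F ι 1#
  ⁻¹F-inverseʳ x@(a ÷ b [ _ ]) x≉0 with a ≟ 0#
  ... | yes a≈0 = contradiction a≈0 (num≉0 x x≉0)
  ... | no _    = trans (*-identityʳ _) (trans (*-comm a b) (sym (*-identityˡ _)))

  0⁻¹F≈0 : ι 0# ⁻¹F ≈F ι 0#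
  0⁻¹F≈0 with 0# ≟ 0#
  ... | yes _  = refl
  ... | no 0≉0 = contradiction refl 0≉0

  fractionField : DecField (c ⊔ ℓ) ℓ
  fractionField = record
    { commutativeRing = fractionRing
    ; _≟_             = _≟F_
    ; 1≉0             = λ p → 1≉0 (num≈0 (ι 1#) p)
    ; _⁻¹             = _⁻¹F
    ; ⁻¹-cong         = λ {x y} → ⁻¹F-cong {x} {y}
    ; ⁻¹-inverseʳ     = ⁻¹F-inverseʳ
    ; 0⁻¹≈0           = 0⁻¹F≈0
    }

words : ∀ {A : Set} → ℕ → List A → List (List A)
words zero    as = [] ∷ []
words (suc k) as = cartesianProductWith _∷_ as (words k as)

-- Permutations of {1, …, n} as words π₁ ⋯ πₙ: all words of length n on the letters
-- 1, …, n that have no repeated letter.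
𝔖 : ℕ → List (List ℕ)
𝔖 n = filter (unique? ℕ._≟_) (words n (applyUpTo suc n))

count : ∀ {P : Set} → Dec P → ℕ
count (yes _) = 1
count (no _)  = 0

des : List ℕ → ℕ
des (a ∷ b ∷ w) = count (b ℕ.<? a) ℕ.+ des (b ∷ w)
des _           = 0

-- Positions 2 ≤ i ≤ n-1 with πᵢ₋₁ < πᵢ > πᵢ₊₁.
interiorPeaks : List ℕ → ℕ
interiorPeaks (a ∷ b ∷ d ∷ w) =
  count ((a ℕ.<? b) ×-dec (d ℕ.<? b)) ℕ.+ interiorPeaks (b ∷ d ∷ w)
interiorPeaks _               = 0

-- The first summand is the left peak condition at i = 1, namely π₁ > π₂.
lpk : List ℕ → ℕ
lpk (a ∷ b ∷ w) = count (b ℕ.<? a) ℕ.+ interiorPeaks (a ∷ b ∷ w)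
lpk _           = 0

val : List ℕ → ℕ
val (a ∷ b ∷ d ∷ w) =
  count ((b ℕ.<? a) ×-dec (b ℕ.<? d)) ℕ.+ val (b ∷ d ∷ w)
val _               = 0

inv : List ℕ → ℕ
inv []      = 0
inv (a ∷ w) = length (filter (ℕ._<? a) w) ℕ.+ inv w

module _ (R : CommutativeRing c ℓ) where
  open CommutativeRing R
  open SemiringExp semiring using (_^_)

  -- The value of Pₙ^(inv,lpk,val,des) at (q, y, z, t) in R.
  P⁽inv,lpk,val,des⁾ : ℕ → Carrier → Carrier → Carrier → Carrier → Carrier
  P⁽inv,lpk,val,des⁾ n q y z t =
    foldr _+_ 0# (map (λ π → q ^ inv π * y ^ lpk π * z ^ val π * t ^ des π) (𝔖 n))

ℤ-domain : DecIntegralDomain 0ℓ 0ℓ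
ℤ-domain = record
  { commutativeRing = ℤ.+-*-commutativeRing
  ; _≟_             = ℤ._≟_
  ; 1≉0             = λ ()
  ; noZeroDivisors  = λ x y → ℤ.i*j≡0⇒i≡0∨j≡0 x
  }

module ℤ[q]     = Polynomial ℤ-domain
module ℤ[q,y]   = Polynomial ℤ[q].polyDomain
module ℤ[q,y,t] = Polynomial ℤ[q,y].polyDomain
module Frac     = FieldOfFractions ℤ[q,y,t].polyDomain

-- The fraction field of ℤ[q,y,t] is also that of ℚ[q,y,t].
ℚ⟨q,y,t⟩ : DecField 0ℓ 0ℓ
ℚ⟨q,y,t⟩ = Frac.fractionField

open DecField ℚ⟨q,y,t⟩ public
  using (_+_; _-_; _*_; _/_; 0#; 1#) renaming (Carrier to K)
open SemiringExp (DecField.semiring ℚ⟨q,y,t⟩) public using (_^_)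
open SeriesDivision ℚ⟨q,y,t⟩ public
  using (Series; _≈ₛ_; const; 1ₛ; _+ₛ_; _-ₛ_; _*ₛ_; _/ₛ_; rescale; ∑≥1)

q y t : K
q = Frac.ι (ℤ[q,y,t].constₚ (ℤ[q,y].constₚ ℤ[q].var))
y = Frac.ι (ℤ[q,y,t].constₚ ℤ[q,y].var)
t = Frac.ι ℤ[q,y,t].var

-- [n]_q = 1 + q + ⋯ + qⁿ⁻¹.
[_]q : ℕ → K
[ zero ]q  = 0#
[ suc n ]q = [ n ]q + q ^ n

[_]q! : ℕ → K
[ zero ]q!  = 1#
[ suc n ]q! = [ n ]q! * [ suc n ]q

exp-q Exp-q : Series
exp-q n = 1# / [ n ]q!
Exp-q n = q ^ (n C 2) / [ n ]q!

-- Every denominator below, like every [n]_q!, is a nonzero polynomial, so that no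
-- division is by zero.
α β γ : K
α = (t * (1# + y) * (y + t)) / ((y + t ^ 2) * (1# + y * t))
β = (t * (1# + y) * (1# + y * t)) / ((1# + y * t ^ 2) * (y + t))
γ = (y + t ^ 2) / (1# + y * t ^ 2)

P : ℕ → K → K → K → K → K
P = P⁽inv,lpk,val,des⁾ (DecField.commutativeRing ℚ⟨q,y,t⟩)

{-# OPTIONS --safe #-}

module Submission where

-- Cut a permutation into m consecutive pieces, possibly empty, the odd ones increasing and
-- the even ones decreasing, with weight q^inv tᵐ and y per letter in an even piece.  As
-- (1-t) (1+te)/(1-t²eE) = (1-t) Σ_m tᵐ · (the product of the first m factors of eEeE⋯),
-- with e = exp_q(x) and E = Exp_q(yx), the left-hand side counts all cuts of all
-- permutations.  For one permutation the sum over its cuts is a product of 2×2 transfer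
-- matrices, one for ascents and one for descents.  Both have rank one, so the product is a
-- monomial in the numbers of ascents, descents and changes of direction, which is the
-- summand of the right-hand side.  The sum over permutations is taken through Lehmer
-- codes: a code has the descents of its permutation, and its entries add up to inv.
open import Algebra.Bundles using (CommutativeRing)
import Algebra.Properties.CommutativeSemigroup as CommutativeSemigroupProperties
import Algebra.Properties.Monoid.Sum as MonoidSum
import Algebra.Properties.Ring as RingProperties
import Algebra.Properties.Semiring.Exp as SemiringExp
import Algebra.Solver.Ring.NaturalCoefficients.Default as SemiringSolver
open import Data.Bool.Base using (true; false; if_then_else_)
open import Data.Fin.Base using (toℕ)
open import Data.Integer.Base as ℤ using (ℤ; 0ℤ; 1ℤ)
import Data.Integer.Properties as ℤ
open import Data.List.Base
  using (List; []; _∷_; _++_; map; foldr; filter; length; concatMap; cartesianProductWith; applyUpTo)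
open import Data.List.Membership.Propositional using (_∈_)
open import Data.List.Properties
  using (filter-all; filter-none; filter-accept; filter-reject; filter-++; concatMap-cong;
         length-applyUpTo)
open import Data.List.Relation.Binary.Permutation.Propositional
  using (_↭_; prep; swap; ↭-refl; ↭-trans)
open import Data.List.Relation.Binary.Permutation.Propositional.Properties
  using (filter-↭; ↭-length)
open import Data.List.Relation.Unary.All as All using (All; []; _∷_)
import Data.List.Relation.Unary.All.Properties as All
open import Data.List.Relation.Unary.AllPairs using (AllPairs; []; _∷_)
import Data.List.Relation.Unary.AllPairs.Properties as AllPairs
open import Data.List.Relation.Unary.Any using (here; there)
open import Data.List.Relation.Unary.Unique.DecPropositional using (unique?)
open import Data.Nat.Base as ℕ using (ℕ; zero; suc; _∸_; _<_; _≤_; _<ᵇ_; z≤n; s≤s)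
open import Data.Nat.Combinatorics using (_C_; nC1≡n; nCk+nC[k+1]≡[n+1]C[k+1])
open import Data.Nat.ListAction using (sum)
import Data.Nat.Properties as ℕ
open import Data.Product.Base using (_×_; _,_; proj₁; proj₂)
open import Defs
  using (DecIntegralDomain; DecField; module SeriesDivision; module Polynomial;
         words; 𝔖; count; des; interiorPeaks; lpk; val; inv; P⁽inv,lpk,val,des⁾)
open import Function.Base using (_∘_)
open import Level using (Level; 0ℓ)
open import Relation.Binary.Definitions using (tri<; tri≈; tri>)
open import Relation.Binary.PropositionalEquality as ≡ using (_≡_; _≢_)
import Relation.Binary.Reasoning.Setoid as SetoidReasoning
open import Relation.Nullary.Decidable using (Dec; yes; no; does; ¬?; dec-true; dec-false)
open import Relation.Nullary.Negation.Core using (¬_; contradiction)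
open import Relation.Unary using (Pred; Decidable)

-- In a Lehmer code the bound on a digit depends only on the number of letters after it, so whatever
-- follows a piece ranges over all codes of its length. A piece is then counted by a q-binomial
-- coefficient: its digits increase weakly, or decrease strictly, within an interval. This gives
-- multiplication by e or E.
--
-- The infinite sum over m is avoided. Let D and C be the series of all cuts whose next piece is
-- increasing or decreasing. Either no piece follows or one is opened, so D = (1-t) + t e C and C =
-- (1-t) + t E D, and eliminating C yields the fraction. The factor 1-t cancels the sum over
-- trailing empty pieces; this is why the empty word has weight 1.
--
-- The constants α, β, γ are dictated by the transfer matrices: they are what remains of the matrix
-- entries once the two weights are divided by their values on one letter and a common factor 1+yt²
-- is taken out of each step.

private variable
  c ℓ : Level
  I J : Set

-- Permutations by their first letter

Sorted Unique : List ℕ → Set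
Sorted = AllPairs _<_
Unique = AllPairs _≢_

_∖_ : List ℕ → ℕ → List ℕ
xs ∖ a = filter (λ b → ¬? (a ℕ.≟ b)) xs

rank : ℕ → List ℕ → ℕ
rank a w = length (filter (ℕ._<? a) w)

code : List ℕ → List ℕ
code []      = []
code (a ∷ w) = rank a w ∷ code w

-- The recursion that matches Lehmer codes: the choice of the first letter becomes the choice of the
-- first digit.
perms : ℕ → List ℕ → List (List ℕ)
perms zero    xs = [] ∷ []
perms (suc n) xs = concatMap (λ a → map (a ∷_) (perms n (xs ∖ a))) xs

filter-map : ∀ {P : Pred J 0ℓ} (P? : Decidable P) (f : I → J) xs →
             filter P? (map f xs) ≡ map f (filter (P? ∘ f) xs)
filter-map P? f []       = ≡.refl
filter-map P? f (x ∷ xs) with does (P? (f x))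
... | true  = ≡.cong (f x ∷_) (filter-map P? f xs)
... | false = filter-map P? f xs

filter-cartesianProductWith-∷ :
  ∀ {P : Pred (List I) 0ℓ} (P? : Decidable P) (xs : List I) ws →
  filter P? (cartesianProductWith _∷_ xs ws) ≡
  concatMap (λ x → map (x ∷_) (filter (P? ∘ (x ∷_)) ws)) xs
filter-cartesianProductWith-∷ P? []       ws = ≡.refl
filter-cartesianProductWith-∷ P? (x ∷ xs) ws =
  ≡.trans (filter-++ P? (map (x ∷_) ws) _)
          (≡.cong₂ _++_ (filter-map P? (x ∷_) ws) (filter-cartesianProductWith-∷ P? xs ws))

-- Serves to turn "no later letter equals `a`" into the removal of `a` from the alphabet.
filter-all?-words : ∀ {P : Pred I 0ℓ} (P? : Decidable P) n xs →
                    filter (All.all? P?) (words n xs) ≡ words n (filter P? xs)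
filter-all?-words P? zero    xs = ≡.refl
filter-all?-words {P} P? (suc n) xs =
  ≡.trans (filter-cartesianProductWith-∷ (All.all? P?) xs (words n xs)) (go xs)
  where
  W = words n xs

  kept : ∀ {x} → does (P? x) ≡ true → ∀ ws →
         filter (All.all? P? ∘ (x ∷_)) ws ≡ filter (All.all? P?) ws
  kept p []       = ≡.refl
  kept {x} p (w ∷ ws) rewrite p with does (All.all? P? w)
  ... | true  = ≡.cong (w ∷_) (kept p ws)
  ... | false = kept p ws

  dropped : ∀ {x} → does (P? x) ≡ false → ∀ ws →
            filter (All.all? P? ∘ (x ∷_)) ws ≡ []
  dropped p []       = ≡.refl
  dropped p (w ∷ ws) rewrite p = dropped p ws

  go : ∀ ys → concatMap (λ y → map (y ∷_) (filter (All.all? P? ∘ (y ∷_)) W)) ys ≡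
              cartesianProductWith _∷_ (filter P? ys) (words n (filter P? xs))
  go []       = ≡.refl
  go (y ∷ ys) with does (P? y) in eq
  ... | true  = ≡.cong₂ _++_
                  (≡.cong (map (y ∷_)) (≡.trans (kept eq W) (filter-all?-words P? n xs)))
                  (go ys)
  ... | false = ≡.cong₂ _++_ (≡.cong (map (y ∷_)) (dropped eq W)) (go ys)

filter-unique?-∷ : ∀ a ws →
  filter (unique? ℕ._≟_ ∘ (a ∷_)) ws ≡
  filter (unique? ℕ._≟_) (filter (All.all? (λ b → ¬? (a ℕ.≟ b))) ws)
filter-unique?-∷ a []       = ≡.refl
filter-unique?-∷ a (w ∷ ws) with does (All.all? (λ b → ¬? (a ℕ.≟ b)) w)
... | false = filter-unique?-∷ a ws
... | true  with does (unique? ℕ._≟_ w)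
...   | true  = ≡.cong (w ∷_) (filter-unique?-∷ a ws)
...   | false = filter-unique?-∷ a ws

filter-unique?-words : ∀ n xs → filter (unique? ℕ._≟_) (words n xs) ≡ perms n xs
filter-unique?-words zero    xs = ≡.refl
filter-unique?-words (suc n) xs =
  ≡.trans (filter-cartesianProductWith-∷ (unique? ℕ._≟_) xs (words n xs))
          (concatMap-cong (λ a → ≡.cong (map (a ∷_)) (begin
            filter (unique? ℕ._≟_ ∘ (a ∷_)) (words n xs)
              ≡⟨ filter-unique?-∷ a (words n xs) ⟩
            filter (unique? ℕ._≟_) (filter (All.all? _) (words n xs))
              ≡⟨ ≡.cong (filter _) (filter-all?-words _ n xs) ⟩
            filter (unique? ℕ._≟_) (words n (xs ∖ a))
              ≡⟨ filter-unique?-words n (xs ∖ a) ⟩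
            perms n (xs ∖ a) ∎)) xs)
  where open ≡.≡-Reasoning

∖-↭ : ∀ {a xs} → Sorted xs → a ∈ xs → a ∷ (xs ∖ a) ↭ xs
∖-↭ {a} {x ∷ xs} (x<xs ∷ _) (here ≡.refl)
  rewrite filter-reject (λ b → ¬? (a ℕ.≟ b)) {a} {xs} (λ a≢a → a≢a ≡.refl)
        | filter-all (λ b → ¬? (a ℕ.≟ b)) (All.map ℕ.<⇒≢ x<xs) = ↭-refl
∖-↭ {a} {x ∷ xs} (x<xs ∷ xs!) (there a∈xs)
  rewrite filter-accept (λ b → ¬? (a ℕ.≟ b)) {x} {xs} (ℕ.>⇒≢ (All.lookup x<xs a∈xs)) =
  ↭-trans (swap a x ↭-refl) (prep x (∖-↭ xs! a∈xs))

length-∖ : ∀ {n a xs} → Sorted xs → a ∈ xs → length xs ≡ suc n → length (xs ∖ a) ≡ n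
length-∖ xs! a∈xs eq = ℕ.suc-injective (≡.trans (↭-length (∖-↭ xs! a∈xs)) eq)

∖-sorted : ∀ {a xs} → Sorted xs → Sorted (xs ∖ a)
∖-sorted = AllPairs.filter⁺ _

-- The first digit of a code counts letters of the tail, so it depends only on the multiset of the
-- tail.
perms-↭ : ∀ n xs → Sorted xs → length xs ≡ n → All (_↭ xs) (perms n xs)
perms-↭ zero    []       _   _  = ↭-refl ∷ []
perms-↭ (suc n) xs xs! eq =
  All.concat⁺ (All.map⁺ (All.tabulate λ {a} a∈xs → All.map⁺
    (All.map (λ p → ↭-trans (prep a p) (∖-↭ xs! a∈xs))
             (perms-↭ n (xs ∖ a) (∖-sorted xs!) (length-∖ xs! a∈xs eq)))))

-- Ranks of letters and descents of Lehmer codes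

rank-↭ : ∀ a {v w} → a ∷ v ↭ w → rank a v ≡ rank a w
rank-↭ a {v} {w} p = begin
  rank a v        ≡⟨ ≡.cong length (filter-reject (ℕ._<? a) (ℕ.<-irrefl ≡.refl)) ⟨
  rank a (a ∷ v)  ≡⟨ ↭-length (filter-↭ (ℕ._<? a) p) ⟩
  rank a w        ∎
  where open ≡.≡-Reasoning

rank-min : ∀ {a xs} → All (a <_) xs → rank a (a ∷ xs) ≡ 0
rank-min {a} a<xs = ≡.cong length
  (filter-none (ℕ._<? a) (ℕ.<-irrefl ≡.refl ∷ All.map ℕ.<-asym a<xs))

rank-∷-< : ∀ {a b} xs → b < a → rank a (b ∷ xs) ≡ suc (rank a xs)
rank-∷-< xs b<a = ≡.cong length (filter-accept (ℕ._<? _) b<a)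

rank-∷-≮ : ∀ {a b} xs → ¬ (b < a) → rank a (b ∷ xs) ≡ rank a xs
rank-∷-≮ xs b≮a = ≡.cong length (filter-reject (ℕ._<? _) b≮a)

rank-mono : ∀ {a b} xs → a ≤ b → rank a xs ≤ rank b xs
rank-mono []       a≤b = z≤n
rank-mono {a} {b} (x ∷ xs) a≤b with x ℕ.<? a
... | yes x<a rewrite rank-∷-< xs x<a | rank-∷-< xs (ℕ.<-≤-trans x<a a≤b) = s≤s (rank-mono xs a≤b)
... | no  x≮a rewrite rank-∷-≮ xs x≮a with x ℕ.<? b
...   | yes x<b rewrite rank-∷-< xs x<b = ℕ.m≤n⇒m≤1+n (rank-mono xs a≤b)
...   | no  x≮b rewrite rank-∷-≮ xs x≮b = rank-mono xs a≤b

<ᵇ-true : ∀ {m n} → m < n → (m <ᵇ n) ≡ true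
<ᵇ-true {m} {n} = dec-true (m ℕ.<? n)

<ᵇ-false : ∀ {m n} → ¬ (m < n) → (m <ᵇ n) ≡ false
<ᵇ-false {m} {n} = dec-false (m ℕ.<? n)

-- If `b < a`, the rank of `a` counts `b` itself besides everything counted by the rank of `b`;
-- otherwise monotonicity of the rank applies. Equal neighbouring digits therefore count as an
-- ascent, and increasing pieces become weakly increasing runs of digits.
rank-descent : ∀ a b w → (rank b w <ᵇ rank a (b ∷ w)) ≡ (b <ᵇ a)
rank-descent a b w with b ℕ.<? a
... | yes b<a rewrite rank-∷-< w b<a =
  ≡.trans (<ᵇ-true (s≤s (rank-mono w (ℕ.<⇒≤ b<a)))) (≡.sym (<ᵇ-true b<a))
... | no  b≮a rewrite rank-∷-≮ w b≮a =
  ≡.trans (<ᵇ-false (ℕ.≤⇒≯ (rank-mono w (ℕ.≮⇒≥ b≮a)))) (≡.sym (<ᵇ-false b≮a))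

-- Change of the statistics when a letter is prepended

count-yes : ∀ {P : Set} (P? : Dec P) → P → count P? ≡ 1
count-yes (yes _) p = ≡.refl
count-yes (no ¬p) p = contradiction p ¬p

count-no : ∀ {P : Set} (P? : Dec P) → ¬ P → count P? ≡ 0
count-no (yes p) ¬p = contradiction p ¬p
count-no (no _)  ¬p = ≡.refl

-- Valleys of the word with an ∞ put in front.
val∞ : List ℕ → ℕ
val∞ (a ∷ b ∷ w) = count (a ℕ.<? b) ℕ.+ val (a ∷ b ∷ w)
val∞ _           = 0

des-asc : ∀ {a b} w → a < b → des (a ∷ b ∷ w) ≡ des (b ∷ w)
des-asc {a} {b} w a<b rewrite count-no (b ℕ.<? a) (ℕ.<-asym a<b) = ≡.refl

-- A smaller letter in front of `b` acts like a 0 there and leads to `lpk` and `val`; a larger one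
-- acts like an ∞ and leads to `interiorPeaks` and `val∞`. These two pairs of statistics are thus
-- closed under prepending a letter.
interiorPeaks-asc : ∀ {a b} w → a < b → interiorPeaks (a ∷ b ∷ w) ≡ lpk (b ∷ w)
interiorPeaks-asc         []      a<b = ≡.refl
interiorPeaks-asc {a} {b} (d ∷ w) a<b with a ℕ.<? b | d ℕ.<? b
... | yes _  | yes _ = ≡.refl
... | yes _  | no _  = ≡.refl
... | no a≮b | _     = contradiction a<b a≮b

lpk-asc : ∀ {a b} w → a < b → lpk (a ∷ b ∷ w) ≡ lpk (b ∷ w)
lpk-asc {a} {b} w a<b rewrite count-no (b ℕ.<? a) (ℕ.<-asym a<b) = interiorPeaks-asc w a<b

val-asc : ∀ {a b} w → a < b → val (a ∷ b ∷ w) ≡ val (b ∷ w)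
val-asc         []      a<b = ≡.refl
val-asc {a} {b} (d ∷ w) a<b with b ℕ.<? a
... | yes b<a = contradiction a<b (ℕ.<-asym b<a)
... | no _    = ≡.refl

val∞-asc : ∀ {a b} w → a < b → val∞ (a ∷ b ∷ w) ≡ suc (val (b ∷ w))
val∞-asc {a} {b} w a<b rewrite count-yes (a ℕ.<? b) a<b = ≡.cong suc (val-asc w a<b)

des-desc : ∀ {a b} w → b < a → des (a ∷ b ∷ w) ≡ suc (des (b ∷ w))
des-desc {a} {b} w b<a rewrite count-yes (b ℕ.<? a) b<a = ≡.refl

interiorPeaks-desc : ∀ {a b} w → b < a → interiorPeaks (a ∷ b ∷ w) ≡ interiorPeaks (b ∷ w)
interiorPeaks-desc         []      b<a = ≡.refl
interiorPeaks-desc {a} {b} (d ∷ w) b<a with a ℕ.<? b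
... | yes a<b = contradiction a<b (ℕ.<-asym b<a)
... | no _    = ≡.refl

lpk-desc : ∀ {a b} w → b < a → lpk (a ∷ b ∷ w) ≡ suc (interiorPeaks (b ∷ w))
lpk-desc {a} {b} w b<a rewrite count-yes (b ℕ.<? a) b<a = ≡.cong suc (interiorPeaks-desc w b<a)

val-desc : ∀ {a b} w → b < a → val (a ∷ b ∷ w) ≡ val∞ (b ∷ w)
val-desc         []      b<a = ≡.refl
val-desc {a} {b} (d ∷ w) b<a with b ℕ.<? a | b ℕ.<? d
... | yes _  | yes _ = ≡.refl
... | yes _  | no _  = ≡.refl
... | no b≮a | _     = contradiction b<a b≮a

val∞-desc : ∀ {a b} w → b < a → val∞ (a ∷ b ∷ w) ≡ val∞ (b ∷ w)
val∞-desc {a} {b} w b<a rewrite count-no (a ℕ.<? b) (ℕ.<-asym b<a) = val-desc w b<a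

-- Sums over permutations as sums over Lehmer codes

inv-code : ∀ w → sum (code w) ≡ inv w
inv-code []      = ≡.refl
inv-code (a ∷ w) = ≡.cong (rank a w ℕ.+_) (inv-code w)

module Sums (R : CommutativeRing c ℓ) where
  open CommutativeRing R
  open MonoidSum +-monoid public using () renaming (sum to ∑ᶠ)
  open CommutativeSemigroupProperties +-commutativeSemigroup using (interchange)
  open SetoidReasoning setoid

  infixl 10 ∑-syntax
  ∑-syntax : ℕ → (ℕ → Carrier) → Carrier
  ∑-syntax n f = ∑ᶠ {n} (f ∘ toℕ)
  syntax ∑-syntax n (λ i → x) = ∑[ i < n ] x

  ∑-cong-< : ∀ n {f g : ℕ → Carrier} → (∀ i → i < n → f i ≈ g i) →
             ∑[ i < n ] f i ≈ ∑[ i < n ] g i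
  ∑-cong-< zero    h = refl
  ∑-cong-< (suc n) h = +-cong (h 0 (s≤s z≤n)) (∑-cong-< n λ i i<n → h (suc i) (s≤s i<n))

  ∑-cong : ∀ n {f g : ℕ → Carrier} → (∀ i → f i ≈ g i) → ∑[ i < n ] f i ≈ ∑[ i < n ] g i
  ∑-cong n h = ∑-cong-< n λ i _ → h i

  ∑-distrib-+ : ∀ n (f g : ℕ → Carrier) →
                ∑[ i < n ] (f i + g i) ≈ ∑[ i < n ] f i + ∑[ i < n ] g i
  ∑-distrib-+ zero    f g = sym (+-identityʳ 0#)
  ∑-distrib-+ (suc n) f g = trans (+-congˡ (∑-distrib-+ n (f ∘ suc) (g ∘ suc))) (interchange _ _ _ _)

  *-distribˡ-∑ : ∀ n a (f : ℕ → Carrier) → a * ∑[ i < n ] f i ≈ ∑[ i < n ] (a * f i)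
  *-distribˡ-∑ zero    a f = zeroʳ a
  *-distribˡ-∑ (suc n) a f = trans (distribˡ _ _ _) (+-congˡ (*-distribˡ-∑ n a (f ∘ suc)))

  ∑-zero : ∀ n {f : ℕ → Carrier} → (∀ i → f i ≈ 0#) → ∑[ i < n ] f i ≈ 0#
  ∑-zero zero    h = refl
  ∑-zero (suc n) h = trans (+-cong (h 0) (∑-zero n (h ∘ suc))) (+-identityʳ 0#)

  ∑-last : ∀ n (f : ℕ → Carrier) → ∑[ i < suc n ] f i ≈ ∑[ i < n ] f i + f n
  ∑-last zero    f = +-comm _ _
  ∑-last (suc n) f = trans (+-congˡ (∑-last n (f ∘ suc))) (sym (+-assoc _ _ _))

  below above : ℕ → (ℕ → Carrier) → ℕ → Carrier
  below k f i = if i <ᵇ k then f i else 0#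
  above k f i = if i <ᵇ k then 0# else f i

  -- Raising the threshold by one admits exactly the term at `k`; the length `suc (k + r)` ensures
  -- that `k` is in range.
  ∑-below-suc : ∀ k r f → ∑[ i < suc (k ℕ.+ r) ] below (suc k) f i ≈
                          ∑[ i < suc (k ℕ.+ r) ] below k f i + f k
  ∑-below-suc zero    r f = begin
    f 0 + ∑[ i < r ] below 0 (f ∘ suc) i         ≈⟨ +-comm _ _ ⟩
    ∑[ i < r ] below 0 (f ∘ suc) i + f 0         ≈⟨ +-congʳ (+-identityˡ _) ⟨
    0# + ∑[ i < r ] below 0 (f ∘ suc) i + f 0    ∎
  ∑-below-suc (suc k) r f = trans (+-congˡ (∑-below-suc k r (f ∘ suc))) (sym (+-assoc _ _ _))

  ∑-above-suc : ∀ k r f → ∑[ i < suc (k ℕ.+ r) ] above k f i ≈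
                          ∑[ i < suc (k ℕ.+ r) ] above (suc k) f i + f k
  ∑-above-suc zero    r f = begin
    f 0 + ∑[ i < r ] f (suc i)         ≈⟨ +-comm _ _ ⟩
    ∑[ i < r ] f (suc i) + f 0         ≈⟨ +-congʳ (+-identityˡ _) ⟨
    0# + ∑[ i < r ] f (suc i) + f 0    ∎
  ∑-above-suc (suc k) r f = trans (+-congˡ (∑-above-suc k r (f ∘ suc))) (sym (+-assoc _ _ _))

  ∑-below-all : ∀ n f → ∑[ i < n ] below n f i ≈ ∑[ i < n ] f i
  ∑-below-all zero    f = refl
  ∑-below-all (suc n) f = +-congˡ (∑-below-all n (f ∘ suc))

  ∑-above-all : ∀ n f → ∑[ i < n ] above n f i ≈ 0#
  ∑-above-all zero    f = refl
  ∑-above-all (suc n) f = trans (+-identityˡ _) (∑-above-all n (f ∘ suc))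

  ∑ₗ : (I → Carrier) → List I → Carrier
  ∑ₗ f xs = foldr _+_ 0# (map f xs)

  ∑ₗ-cong : ∀ {f g : I → Carrier} {xs} → All (λ x → f x ≈ g x) xs → ∑ₗ f xs ≈ ∑ₗ g xs
  ∑ₗ-cong []       = refl
  ∑ₗ-cong (p ∷ ps) = +-cong p (∑ₗ-cong ps)

  *-distribˡ-∑ₗ : ∀ a (f : I → Carrier) xs → a * ∑ₗ f xs ≈ ∑ₗ (λ x → a * f x) xs
  *-distribˡ-∑ₗ a f []       = zeroʳ a
  *-distribˡ-∑ₗ a f (x ∷ xs) = trans (distribˡ _ _ _) (+-congˡ (*-distribˡ-∑ₗ a f xs))

  ∑ₗ-++ : ∀ (f : I → Carrier) xs ys → ∑ₗ f (xs ++ ys) ≈ ∑ₗ f xs + ∑ₗ f ys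
  ∑ₗ-++ f []       ys = sym (+-identityˡ _)
  ∑ₗ-++ f (x ∷ xs) ys = trans (+-congˡ (∑ₗ-++ f xs ys)) (sym (+-assoc _ _ _))

  ∑ₗ-map : ∀ (f : J → Carrier) (g : I → J) xs → ∑ₗ f (map g xs) ≈ ∑ₗ (f ∘ g) xs
  ∑ₗ-map f g []       = refl
  ∑ₗ-map f g (x ∷ xs) = +-congˡ (∑ₗ-map f g xs)

  ∑ₗ-concatMap : ∀ (f : J → Carrier) (g : I → List J) xs →
                 ∑ₗ f (concatMap g xs) ≈ ∑ₗ (λ x → ∑ₗ f (g x)) xs
  ∑ₗ-concatMap f g []       = refl
  ∑ₗ-concatMap f g (x ∷ xs) = trans (∑ₗ-++ f (g x) (concatMap g xs)) (+-congˡ (∑ₗ-concatMap f g xs))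

  -- The least letter has rank 0 and raises the rank of every other letter by one, hence `f ∘ suc`
  -- in the recursion.
  ∑ₗ-rank : ∀ (f : ℕ → Carrier) {xs} → Sorted xs →
            ∑ₗ (λ a → f (rank a xs)) xs ≈ ∑[ k < length xs ] f k
  ∑ₗ-rank f []           = refl
  ∑ₗ-rank f {x ∷ xs} (x<xs ∷ xs!) = +-cong
    (reflexive (≡.cong f (rank-min x<xs)))
    (trans (∑ₗ-cong (All.map (λ x<a → reflexive (≡.cong f (rank-∷-< xs x<a))) x<xs))
           (∑ₗ-rank (f ∘ suc) xs!))

  -- The Lehmer codes of length n are the words k₁ ⋯ kₙ with 0 ≤ kᵢ ≤ n - i.
  ∑codes : ℕ → (List ℕ → Carrier) → Carrier
  ∑codes zero    f = f []
  ∑codes (suc n) f = ∑[ k < suc n ] ∑codes n (f ∘ (k ∷_))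

  ∑codes-cong : ∀ n {f g} → (∀ w → f w ≈ g w) → ∑codes n f ≈ ∑codes n g
  ∑codes-cong zero    h = h []
  ∑codes-cong (suc n) h = ∑-cong (suc n) λ k → ∑codes-cong n (h ∘ (k ∷_))

  ∑codes-+ : ∀ n f g → ∑codes n (λ w → f w + g w) ≈ ∑codes n f + ∑codes n g
  ∑codes-+ zero    f g = refl
  ∑codes-+ (suc n) f g = trans
    (∑-cong (suc n) λ k → ∑codes-+ n (f ∘ (k ∷_)) (g ∘ (k ∷_)))
    (∑-distrib-+ (suc n) (λ k → ∑codes n (f ∘ (k ∷_))) (λ k → ∑codes n (g ∘ (k ∷_))))

  ∑codes-* : ∀ n a f → ∑codes n (λ w → a * f w) ≈ a * ∑codes n f
  ∑codes-* zero    a f = refl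
  ∑codes-* (suc n) a f = trans
    (∑-cong (suc n) λ k → ∑codes-* n a (f ∘ (k ∷_)))
    (sym (*-distribˡ-∑ (suc n) a (λ k → ∑codes n (f ∘ (k ∷_)))))

  -- The first digit is the rank of the first letter in the whole alphabet, which takes each
  -- possible value once; the remaining digits range over the same codes whichever letter was
  -- removed.
  ∑-perms : ∀ n (f : List ℕ → Carrier) {xs} → Sorted xs → length xs ≡ n →
            ∑ₗ (f ∘ code) (perms n xs) ≈ ∑codes n f
  ∑-perms zero    f {[]} _   _  = +-identityʳ _
  ∑-perms (suc n) f {xs} xs! eq = begin
    ∑ₗ (f ∘ code) (perms (suc n) xs)
      ≈⟨ ∑ₗ-concatMap (f ∘ code) _ xs ⟩
    ∑ₗ (λ a → ∑ₗ (f ∘ code) (map (a ∷_) (perms n (xs ∖ a)))) xs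
      ≈⟨ ∑ₗ-cong (All.tabulate firstLetter) ⟩
    ∑ₗ (λ a → ∑codes n (f ∘ (rank a xs ∷_))) xs
      ≈⟨ ∑ₗ-rank (λ k → ∑codes n (f ∘ (k ∷_))) xs! ⟩
    ∑[ k < length xs ] ∑codes n (f ∘ (k ∷_))
      ≡⟨ ≡.cong (λ m → ∑[ k < m ] ∑codes n (f ∘ (k ∷_))) eq ⟩
    ∑codes (suc n) f ∎
    where
    firstLetter : ∀ {a} → a ∈ xs → ∑ₗ (f ∘ code) (map (a ∷_) (perms n (xs ∖ a))) ≈
                                   ∑codes n (f ∘ (rank a xs ∷_))
    firstLetter {a} a∈xs = begin
      ∑ₗ (f ∘ code) (map (a ∷_) (perms n (xs ∖ a)))
        ≈⟨ ∑ₗ-map (f ∘ code) (a ∷_) (perms n (xs ∖ a)) ⟩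
      ∑ₗ (λ π → f (rank a π ∷ code π)) (perms n (xs ∖ a))
        ≈⟨ ∑ₗ-cong (All.map
             (λ p → reflexive (≡.cong (λ k → f (k ∷ _))
                      (rank-↭ a (↭-trans (prep a p) (∖-↭ xs! a∈xs)))))
             (perms-↭ n (xs ∖ a) (∖-sorted xs!) len)) ⟩
      ∑ₗ (λ π → f (rank a xs ∷ code π)) (perms n (xs ∖ a))
        ≈⟨ ∑-perms n (f ∘ (rank a xs ∷_)) (∖-sorted xs!) len ⟩
      ∑codes n (f ∘ (rank a xs ∷_)) ∎
      where len = length-∖ xs! a∈xs eq

  ∑-𝔖 : ∀ n (f : List ℕ → Carrier) → ∑ₗ (f ∘ code) (𝔖 n) ≈ ∑codes n f
  ∑-𝔖 n f = trans
    (reflexive (≡.cong (∑ₗ (f ∘ code)) (filter-unique?-words n (applyUpTo suc n))))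
    (∑-perms n f (AllPairs.applyUpTo⁺₁ suc n (λ i<j _ → s≤s i<j)) (length-applyUpTo suc n))

𝔖-length : ∀ n → All (λ π → length π ≡ n) (𝔖 n)
𝔖-length n rewrite filter-unique?-words n (applyUpTo suc n) =
  All.map (λ p → ≡.trans (↭-length p) (length-applyUpTo suc n))
    (perms-↭ n (applyUpTo suc n) (AllPairs.applyUpTo⁺₁ suc n (λ i<j _ → s≤s i<j))
             (length-applyUpTo suc n))

𝔖-unique : ∀ n → All Unique (𝔖 n)
𝔖-unique n = All.all-filter (unique? ℕ._≟_) (words n (applyUpTo suc n))

-- q-binomial coefficients

module QBinomial (R : CommutativeRing c ℓ) (q : CommutativeRing.Carrier R) where
  open CommutativeRing R hiding (zero)
  open Sums R
  open SemiringExp semiring using (_^_; ^-homo-*)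
  open SemiringSolver commutativeSemiring using (solve; con; _:+_; _:*_; _:=_)
  open SetoidReasoning setoid

  qbinom : ℕ → ℕ → Carrier
  qbinom n       zero    = 1#
  qbinom zero    (suc m) = 0#
  qbinom (suc n) (suc m) = q ^ suc m * qbinom n (suc m) + qbinom n m

  qbinom-zero : ∀ {n m} → n < m → qbinom n m ≈ 0#
  qbinom-zero {zero}  (s≤s _)       = refl
  qbinom-zero {suc n} (s≤s n<m) = trans
    (+-cong (trans (*-congˡ (qbinom-zero (ℕ.m<n⇒m<1+n n<m))) (zeroʳ _)) (qbinom-zero n<m))
    (+-identityʳ 0#)

  -- The other Pascal rule, with q^(n-m) replaced by qⁿ on one side and qᵐ on the other.
  qbinom-suc′ : ∀ n m → q ^ m * qbinom (suc n) (suc m) ≈ q ^ m * qbinom n (suc m) + q ^ n * qbinom n m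
  qbinom-suc′ zero zero =
    solve 1 (λ x → con 1 :* (x :* con 0 :+ con 1) := con 1 :* con 0 :+ con 1 :* con 1) refl (q ^ 1)
  qbinom-suc′ zero (suc m) =
    solve 2 (λ x z → x :* (z :* con 0 :+ con 0) := x :* con 0 :+ con 1 :* con 0)
      refl (q ^ suc m) (q ^ suc (suc m))
  qbinom-suc′ (suc n) zero = begin
    1# * (q ^ 1 * qbinom (suc n) 1 + 1#)
      ≈⟨ solve 2 (λ x b → con 1 :* (x :* b :+ con 1) := x :* (con 1 :* b) :+ con 1)
           refl (q ^ 1) (qbinom (suc n) 1) ⟩
    q ^ 1 * (1# * qbinom (suc n) 1) + 1#
      ≈⟨ +-congʳ (*-congˡ (qbinom-suc′ n zero)) ⟩
    q ^ 1 * (1# * qbinom n 1 + q ^ n * 1#) + 1#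
      ≈⟨ solve 3 (λ q b p → q :* con 1 :* (con 1 :* b :+ p :* con 1) :+ con 1 :=
                            con 1 :* (q :* con 1 :* b :+ con 1) :+ q :* p :* con 1)
           refl q (qbinom n 1) (q ^ n) ⟩
    1# * (q ^ 1 * qbinom n 1 + 1#) + q ^ suc n * 1# ∎
  qbinom-suc′ (suc n) (suc m) = begin
    q ^ suc m * (q ^ suc (suc m) * qbinom (suc n) (suc (suc m)) + qbinom (suc n) (suc m))
      ≈⟨ solve 4 (λ q x b b′ → (q :* x) :* (q :* (q :* x) :* b :+ b′) :=
                               q :* (q :* x) :* (q :* x :* b) :+ q :* (x :* b′))
           refl q (q ^ m) _ _ ⟩
    q ^ suc (suc m) * (q ^ suc m * qbinom (suc n) (suc (suc m))) + q * (q ^ m * qbinom (suc n) (suc m))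
      ≈⟨ +-cong (*-congˡ (qbinom-suc′ n (suc m))) (*-congˡ (qbinom-suc′ n m)) ⟩
    q ^ suc (suc m) * (q ^ suc m * b₂ + q ^ n * b₁) + q * (q ^ m * b₁ + q ^ n * b₀)
      ≈⟨ solve 6 (λ q x z b₀ b₁ b₂ →
             q :* (q :* x) :* (q :* x :* b₂ :+ z :* b₁) :+ q :* (x :* b₁ :+ z :* b₀) :=
             q :* x :* (q :* (q :* x) :* b₂ :+ b₁) :+ q :* z :* (q :* x :* b₁ :+ b₀))
           refl q (q ^ m) (q ^ n) b₀ b₁ b₂ ⟩
    q ^ suc m * (q ^ suc (suc m) * b₂ + b₁) + q ^ suc n * (q ^ suc m * b₁ + b₀) ∎
    where b₀ = qbinom n m ; b₁ = qbinom n (suc m) ; b₂ = qbinom n (suc (suc m))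

  ∑-qbinom-extend : ∀ n (f : ℕ → Carrier) →
    ∑[ m < suc (suc n) ] (qbinom n m * f m) ≈ ∑[ m < suc n ] (qbinom n m * f m)
  ∑-qbinom-extend n f = begin
    ∑[ m < suc (suc n) ] (qbinom n m * f m)
      ≈⟨ ∑-last (suc n) (λ m → qbinom n m * f m) ⟩
    ∑[ m < suc n ] (qbinom n m * f m) + qbinom n (suc n) * f (suc n)
      ≈⟨ +-congˡ (trans (*-congʳ (qbinom-zero (ℕ.n<1+n n))) (zeroˡ _)) ⟩
    ∑[ m < suc n ] (qbinom n m * f m) + 0#
      ≈⟨ +-identityʳ _ ⟩
    ∑[ m < suc n ] (qbinom n m * f m) ∎

  -- The Pascal rule in the shape needed for weakly increasing digits: either all `m` of them exceed
  -- the lower bound, which costs `q ^ m`, or the first one equals it, which shifts the index.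
  ∑-qbinom-suc : ∀ n (f : ℕ → Carrier) →
    ∑[ m < suc (suc n) ] (qbinom (suc n) m * f m) ≈
    ∑[ m < suc n ] (qbinom n m * (q ^ m * f m)) + ∑[ m < suc n ] (qbinom n m * f (suc m))
  ∑-qbinom-suc n f = begin
    1# * f 0 + ∑[ m < suc n ] ((q ^ suc m * qbinom n (suc m) + qbinom n m) * f (suc m))
      ≈⟨ +-cong (sym (*-congˡ (*-identityˡ _))) (∑-cong (suc n) λ m →
           solve 4 (λ x b b′ g → (x :* b :+ b′) :* g := b :* (x :* g) :+ b′ :* g)
             refl (q ^ suc m) (qbinom n (suc m)) (qbinom n m) (f (suc m))) ⟩
    1# * (1# * f 0) +
      ∑[ m < suc n ] (qbinom n (suc m) * (q ^ suc m * f (suc m)) + qbinom n m * f (suc m))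
      ≈⟨ +-congˡ (∑-distrib-+ (suc n) (λ m → qbinom n (suc m) * (q ^ suc m * f (suc m)))
                                      (λ m → qbinom n m * f (suc m))) ⟩
    1# * (1# * f 0) + (∑[ m < suc n ] (qbinom n (suc m) * (q ^ suc m * f (suc m))) +
                       ∑[ m < suc n ] (qbinom n m * f (suc m)))
      ≈⟨ +-assoc _ _ _ ⟨
    ∑[ m < suc (suc n) ] (qbinom n m * (q ^ m * f m)) + ∑[ m < suc n ] (qbinom n m * f (suc m))
      ≈⟨ +-congʳ (∑-qbinom-extend n (λ m → q ^ m * f m)) ⟩
    ∑[ m < suc n ] (qbinom n m * (q ^ m * f m)) + ∑[ m < suc n ] (qbinom n m * f (suc m)) ∎

  q^[1+m]C2 : ∀ m → q ^ (suc m C 2) ≈ q ^ m * q ^ (m C 2)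
  q^[1+m]C2 m = trans
    (reflexive (≡.cong (q ^_) (≡.trans (≡.sym (nCk+nC[k+1]≡[n+1]C[k+1] m 1))
                                       (≡.cong (ℕ._+ m C 2) (nC1≡n m)))))
    (^-homo-* q m (m C 2))

  -- The counterpart for strictly decreasing digits, where `q ^ n` records a leading digit `n`. The
  -- exponent of q at `suc m` supplies the factor `q ^ m` that the second Pascal rule requires.
  ∑-qbinom-suc′ : ∀ n (f : ℕ → Carrier) →
    ∑[ m < suc (suc n) ] (qbinom (suc n) m * (q ^ (m C 2) * f m)) ≈
    ∑[ m < suc n ] (qbinom n m * (q ^ (m C 2) * f m)) +
    q ^ n * ∑[ m < suc n ] (qbinom n m * (q ^ (m C 2) * f (suc m)))
  ∑-qbinom-suc′ n f = begin
    g 0 + ∑[ m < suc n ] (qbinom (suc n) (suc m) * (q ^ (suc m C 2) * f (suc m)))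
      ≈⟨ +-congˡ (∑-cong (suc n) summand) ⟩
    g 0 + ∑[ m < suc n ] (g (suc m) + q ^ n * h m)
      ≈⟨ +-congˡ (∑-distrib-+ (suc n) (g ∘ suc) (λ m → q ^ n * h m)) ⟩
    g 0 + (∑[ m < suc n ] g (suc m) + ∑[ m < suc n ] (q ^ n * h m))
      ≈⟨ +-assoc _ _ _ ⟨
    ∑[ m < suc (suc n) ] g m + ∑[ m < suc n ] (q ^ n * h m)
      ≈⟨ +-cong (∑-qbinom-extend n (λ m → q ^ (m C 2) * f m))
                (sym (*-distribˡ-∑ (suc n) (q ^ n) h)) ⟩
    ∑[ m < suc n ] g m + q ^ n * ∑[ m < suc n ] h m ∎
    where
    g h : ℕ → Carrier
    g m = qbinom n m * (q ^ (m C 2) * f m)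
    h m = qbinom n m * (q ^ (m C 2) * f (suc m))

    summand : ∀ m → qbinom (suc n) (suc m) * (q ^ (suc m C 2) * f (suc m)) ≈ g (suc m) + q ^ n * h m
    summand m = begin
      qbinom (suc n) (suc m) * (q ^ (suc m C 2) * f (suc m))
        ≈⟨ *-congˡ (*-congʳ (q^[1+m]C2 m)) ⟩
      qbinom (suc n) (suc m) * (q ^ m * q ^ (m C 2) * f (suc m))
        ≈⟨ solve 4 (λ b x e z → b :* (x :* e :* z) := x :* b :* (e :* z))
             refl (qbinom (suc n) (suc m)) (q ^ m) (q ^ (m C 2)) (f (suc m)) ⟩
      q ^ m * qbinom (suc n) (suc m) * (q ^ (m C 2) * f (suc m))
        ≈⟨ *-congʳ (qbinom-suc′ n m) ⟩
      (q ^ m * qbinom n (suc m) + q ^ n * qbinom n m) * (q ^ (m C 2) * f (suc m))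
        ≈⟨ solve 6 (λ x b p b′ e z → (x :* b :+ p :* b′) :* (e :* z) :=
                                     b :* (x :* e :* z) :+ p :* (b′ :* (e :* z)))
             refl (q ^ m) (qbinom n (suc m)) (q ^ n) (qbinom n m) (q ^ (m C 2)) (f (suc m)) ⟩
      qbinom n (suc m) * (q ^ m * q ^ (m C 2) * f (suc m)) + q ^ n * h m
        ≈⟨ +-congʳ (*-congˡ (*-congʳ (q^[1+m]C2 m))) ⟨
      g (suc m) + q ^ n * h m ∎

  module Factorial
    (⟦_⟧ ⟦_⟧! : ℕ → Carrier)
    (⟦0⟧ : ⟦ 0 ⟧ ≈ 0#) (⟦suc⟧ : ∀ n → ⟦ suc n ⟧ ≈ ⟦ n ⟧ + q ^ n)
    (⟦0⟧! : ⟦ 0 ⟧! ≈ 1#) (⟦suc⟧! : ∀ n → ⟦ suc n ⟧! ≈ ⟦ n ⟧! * ⟦ suc n ⟧)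
    where

    ⟦⟧-+ : ∀ m n → ⟦ m ℕ.+ n ⟧ ≈ q ^ m * ⟦ n ⟧ + ⟦ m ⟧
    ⟦⟧-+ m zero    rewrite ℕ.+-identityʳ m = sym (begin
      q ^ m * ⟦ 0 ⟧ + ⟦ m ⟧  ≈⟨ +-congʳ (trans (*-congˡ ⟦0⟧) (zeroʳ _)) ⟩
      0# + ⟦ m ⟧             ≈⟨ +-identityˡ _ ⟩
      ⟦ m ⟧                  ∎)
    ⟦⟧-+ m (suc n) rewrite ℕ.+-suc m n = begin
      ⟦ suc (m ℕ.+ n) ⟧
        ≈⟨ ⟦suc⟧ (m ℕ.+ n) ⟩
      ⟦ m ℕ.+ n ⟧ + q ^ (m ℕ.+ n)
        ≈⟨ +-cong (⟦⟧-+ m n) (^-homo-* q m n) ⟩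
      q ^ m * ⟦ n ⟧ + ⟦ m ⟧ + q ^ m * q ^ n
        ≈⟨ solve 4 (λ p i j r → p :* i :+ j :+ p :* r := p :* (i :+ r) :+ j)
             refl (q ^ m) ⟦ n ⟧ ⟦ m ⟧ (q ^ n) ⟩
      q ^ m * (⟦ n ⟧ + q ^ n) + ⟦ m ⟧
        ≈⟨ +-congʳ (*-congˡ (⟦suc⟧ n)) ⟨
      q ^ m * ⟦ suc n ⟧ + ⟦ m ⟧ ∎

    mutual
      qbinom-! : ∀ m n → qbinom (m ℕ.+ n) m * (⟦ m ⟧! * ⟦ n ⟧!) ≈ ⟦ m ℕ.+ n ⟧!
      qbinom-! zero    n = begin
        1# * (⟦ 0 ⟧! * ⟦ n ⟧!)  ≈⟨ *-identityˡ _ ⟩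
        ⟦ 0 ⟧! * ⟦ n ⟧!         ≈⟨ *-congʳ ⟦0⟧! ⟩
        1# * ⟦ n ⟧!             ≈⟨ *-identityˡ _ ⟩
        ⟦ n ⟧!                  ∎
      qbinom-! (suc m) n = begin
        (p * b₁ + b₀) * (⟦ suc m ⟧! * ⟦ n ⟧!)
          ≈⟨ solve 5 (λ p b₁ b₀ i j → (p :* b₁ :+ b₀) :* (i :* j) :=
                                       p :* (b₁ :* (i :* j)) :+ b₀ :* (i :* j))
               refl p b₁ b₀ _ _ ⟩
        p * (b₁ * (⟦ suc m ⟧! * ⟦ n ⟧!)) + b₀ * (⟦ suc m ⟧! * ⟦ n ⟧!)
          ≈⟨ +-cong (*-congˡ (qbinom-!-shift m n)) (*-congˡ (*-congʳ (⟦suc⟧! m))) ⟩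
        p * (⟦ m ℕ.+ n ⟧! * ⟦ n ⟧) + b₀ * (⟦ m ⟧! * ⟦ suc m ⟧ * ⟦ n ⟧!)
          ≈⟨ +-congˡ (solve 4 (λ b i k j → b :* (i :* k :* j) := b :* (i :* j) :* k)
                       refl b₀ ⟦ m ⟧! ⟦ suc m ⟧ ⟦ n ⟧!) ⟩
        p * (⟦ m ℕ.+ n ⟧! * ⟦ n ⟧) + b₀ * (⟦ m ⟧! * ⟦ n ⟧!) * ⟦ suc m ⟧
          ≈⟨ +-congˡ (*-congʳ (qbinom-! m n)) ⟩
        p * (⟦ m ℕ.+ n ⟧! * ⟦ n ⟧) + ⟦ m ℕ.+ n ⟧! * ⟦ suc m ⟧
          ≈⟨ solve 4 (λ p f i j → p :* (f :* i) :+ f :* j := f :* (p :* i :+ j))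
               refl p ⟦ m ℕ.+ n ⟧! ⟦ n ⟧ ⟦ suc m ⟧ ⟩
        ⟦ m ℕ.+ n ⟧! * (p * ⟦ n ⟧ + ⟦ suc m ⟧)
          ≈⟨ *-congˡ (⟦⟧-+ (suc m) n) ⟨
        ⟦ m ℕ.+ n ⟧! * ⟦ suc (m ℕ.+ n) ⟧
          ≈⟨ ⟦suc⟧! (m ℕ.+ n) ⟨
        ⟦ suc (m ℕ.+ n) ⟧! ∎
        where p = q ^ suc m ; b₀ = qbinom (m ℕ.+ n) m ; b₁ = qbinom (m ℕ.+ n) (suc m)

      -- The factorial formula for the other term of the Pascal rule, multiplied by `⟦ n ⟧` to avoid
      -- `n - 1`; at `n = 0` both sides vanish.
      qbinom-!-shift : ∀ m n → qbinom (m ℕ.+ n) (suc m) * (⟦ suc m ⟧! * ⟦ n ⟧!) ≈ ⟦ m ℕ.+ n ⟧! * ⟦ n ⟧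
      qbinom-!-shift m zero    = begin
        qbinom (m ℕ.+ 0) (suc m) * (⟦ suc m ⟧! * ⟦ 0 ⟧!)
          ≈⟨ *-congʳ (qbinom-zero (s≤s (ℕ.≤-reflexive (ℕ.+-identityʳ m)))) ⟩
        0# * (⟦ suc m ⟧! * ⟦ 0 ⟧!)
          ≈⟨ zeroˡ _ ⟩
        0#
          ≈⟨ trans (*-congˡ ⟦0⟧) (zeroʳ _) ⟨
        ⟦ m ℕ.+ 0 ⟧! * ⟦ 0 ⟧ ∎
      qbinom-!-shift m (suc n) rewrite ℕ.+-suc m n = begin
        b * (⟦ suc m ⟧! * ⟦ suc n ⟧!)
          ≈⟨ *-congˡ (*-congˡ (⟦suc⟧! n)) ⟩
        b * (⟦ suc m ⟧! * (⟦ n ⟧! * ⟦ suc n ⟧))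
          ≈⟨ solve 4 (λ b i j k → b :* (i :* (j :* k)) := b :* (i :* j) :* k)
               refl b _ _ _ ⟩
        b * (⟦ suc m ⟧! * ⟦ n ⟧!) * ⟦ suc n ⟧
          ≈⟨ *-congʳ (qbinom-! (suc m) n) ⟩
        ⟦ suc (m ℕ.+ n) ⟧! * ⟦ suc n ⟧ ∎
        where b = qbinom (suc (m ℕ.+ n)) (suc m)

-- Weights of cuts

module _ (R : CommutativeRing c ℓ) where
  open CommutativeRing R hiding (zero)

  module Weights (q y t σ : Carrier) (σ-unfold : σ ≈ 1# + t * t * σ) where
    open Sums R
    open QBinomial R q
    open SemiringExp semiring using (_^_; ^-homo-*)
    open SemiringSolver commutativeSemiring using (solve; con; _:+_; _:*_; _:=_)
    open SetoidReasoning setoid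

    -- Cut a word into consecutive pieces, alternately of increasing and of decreasing type
    -- and possibly empty, such that the word is monotone on each piece.  A cut has weight
    -- y per letter in a decreasing piece and t per new piece, and σ = 1/(1-t²) sums over the
    -- empty pieces skipped between two letters.  The weights sum up the cuts of w when a
    -- last piece already open is increasing (weight↑) or decreasing (weight↓) and may not be
    -- continued; in up k w and down k w the letter k in that piece precedes w and the piece
    -- may be continued.
    mutual
      weight↑ weight↓ : List ℕ → Carrier
      weight↑ []      = 1#
      weight↑ (k ∷ w) = σ * (t * (t * up k w + y * down k w))
      weight↓ []      = 1#
      weight↓ (k ∷ w) = σ * (t * (up k w + t * (y * down k w)))

      up down : ℕ → List ℕ → Carrier
      up   k []      = 1#
      up   k (b ∷ w) = weight↑ (b ∷ w) + above k (λ b → up b w) b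
      down k []      = 1#
      down k (b ∷ w) = weight↓ (b ∷ w) + below k (λ b → y * down b w) b

    -- Open a single decreasing piece at the cost of t: it stays empty or it takes `k`. Together
    -- with `weight↓-∷` this would be circular as a definition, each weight referring to the other
    -- on the same word; `σ` resolves the circle.
    weight↑-∷ : ∀ k w → weight↑ (k ∷ w) ≈ t * weight↓ (k ∷ w) + t * (y * down k w)
    weight↑-∷ k w = begin
      σ * (t * (t * u + v))
        ≈⟨ solve 4 (λ σ t u v → σ :* (t :* (t :* u :+ v)) := σ :* (t :* (t :* u)) :+ t :* v :* σ)
             refl σ t u v ⟩
      σ * (t * (t * u)) + t * v * σ
        ≈⟨ +-congˡ (*-congˡ σ-unfold) ⟩
      σ * (t * (t * u)) + t * v * (1# + t * t * σ)
        ≈⟨ solve 4 (λ σ t u v → σ :* (t :* (t :* u)) :+ t :* v :* (con 1 :+ t :* t :* σ) :=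
                                t :* (σ :* (t :* (u :+ t :* v))) :+ t :* v) refl σ t u v ⟩
      t * (σ * (t * (u + t * v))) + t * v ∎
      where u = up k w ; v = y * down k w

    weight↓-∷ : ∀ k w → weight↓ (k ∷ w) ≈ t * weight↑ (k ∷ w) + t * up k w
    weight↓-∷ k w = begin
      σ * (t * (u + t * v))
        ≈⟨ solve 4 (λ σ t u v → σ :* (t :* (u :+ t :* v)) := σ :* (t :* (t :* v)) :+ t :* u :* σ)
             refl σ t u v ⟩
      σ * (t * (t * v)) + t * u * σ
        ≈⟨ +-congˡ (*-congˡ σ-unfold) ⟩
      σ * (t * (t * v)) + t * u * (1# + t * t * σ)
        ≈⟨ solve 4 (λ σ t u v → σ :* (t :* (t :* v)) :+ t :* u :* (con 1 :+ t :* t :* σ) :=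
                                t :* (σ :* (t :* (t :* u :+ v))) :+ t :* u) refl σ t u v ⟩
      t * (σ * (t * (t * u + v))) + t * u ∎
      where u = up k w ; v = y * down k w

    module _ {k b : ℕ} (w : List ℕ) where
      private
        C = weight↑ (b ∷ w)
        D = weight↓ (b ∷ w)

      module _ (b≮k : (b <ᵇ k) ≡ false) where
        private
          t*up : t * up k (b ∷ w) ≈ D
          t*up rewrite b≮k = trans (distribˡ t _ _) (sym (weight↓-∷ b w))

          down≈ : down k (b ∷ w) ≈ D
          down≈ rewrite b≮k = +-identityʳ _

        -- At an ascent a decreasing piece has to be cut, which leaves `D`. An increasing piece may
        -- be cut or continued, and by `weight↓-∷` these two options add up to `D` after
        -- multiplication by t. Both weights see only `D`, hence rank one.
        weight↑-asc : weight↑ (k ∷ b ∷ w) ≈ σ * (t * (1# + y)) * D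
        weight↑-asc = begin
          σ * (t * (t * up k (b ∷ w) + y * down k (b ∷ w)))
            ≈⟨ *-congˡ (*-congˡ (+-cong t*up (*-congˡ down≈))) ⟩
          σ * (t * (D + y * D))
            ≈⟨ solve 4 (λ σ t y D → σ :* (t :* (D :+ y :* D)) := σ :* (t :* (con 1 :+ y)) :* D)
                 refl σ t y D ⟩
          σ * (t * (1# + y)) * D ∎

        weight↓-asc : weight↓ (k ∷ b ∷ w) ≈ σ * (1# + y * t ^ 2) * D
        weight↓-asc = begin
          σ * (t * (up k (b ∷ w) + t * (y * down k (b ∷ w))))
            ≈⟨ *-congˡ (trans (distribˡ t _ _) (+-cong t*up (*-congˡ (*-congˡ (*-congˡ down≈))))) ⟩
          σ * (D + t * (t * (y * D)))
            ≈⟨ solve 4 (λ σ t y D → σ :* (D :+ t :* (t :* (y :* D))) :=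
                                    σ :* (con 1 :+ y :* (t :* (t :* con 1))) :* D) refl σ t y D ⟩
          σ * (1# + y * t ^ 2) * D ∎

      module _ (b<k : (b <ᵇ k) ≡ true) where
        private
          up≈ : up k (b ∷ w) ≈ C
          up≈ rewrite b<k = +-identityʳ _

          t*down : t * down k (b ∷ w) ≈ C
          t*down rewrite b<k = trans (distribˡ t _ _) (sym (weight↑-∷ b w))

        -- The mirror image: at a descent the increasing piece has to be cut, and the options for a
        -- decreasing one add up by `weight↑-∷`.
        weight↑-desc : weight↑ (k ∷ b ∷ w) ≈ σ * (y + t ^ 2) * C
        weight↑-desc = begin
          σ * (t * (t * up k (b ∷ w) + y * down k (b ∷ w)))
            ≈⟨ solve 5 (λ σ t y u v → σ :* (t :* (t :* u :+ y :* v)) :=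
                                      σ :* (t :* (t :* u) :+ y :* (t :* v))) refl σ t y _ _ ⟩
          σ * (t * (t * up k (b ∷ w)) + y * (t * down k (b ∷ w)))
            ≈⟨ *-congˡ (+-cong (*-congˡ (*-congˡ up≈)) (*-congˡ t*down)) ⟩
          σ * (t * (t * C) + y * C)
            ≈⟨ solve 4 (λ σ t y C → σ :* (t :* (t :* C) :+ y :* C) :=
                                    σ :* (y :+ t :* (t :* con 1)) :* C) refl σ t y C ⟩
          σ * (y + t ^ 2) * C ∎

        weight↓-desc : weight↓ (k ∷ b ∷ w) ≈ σ * (t * (1# + y)) * C
        weight↓-desc = begin
          σ * (t * (up k (b ∷ w) + t * (y * down k (b ∷ w))))
            ≈⟨ solve 5 (λ σ t y u v → σ :* (t :* (u :+ t :* (y :* v))) :=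
                                      σ :* (t :* (u :+ y :* (t :* v)))) refl σ t y _ _ ⟩
          σ * (t * (up k (b ∷ w) + y * (t * down k (b ∷ w))))
            ≈⟨ *-congˡ (*-congˡ (+-cong up≈ (*-congˡ t*down))) ⟩
          σ * (t * (C + y * C))
            ≈⟨ solve 4 (λ σ t y C → σ :* (t :* (C :+ y :* C)) := σ :* (t :* (con 1 :+ y)) :* C)
                 refl σ t y C ⟩
          σ * (t * (1# + y)) * C ∎

    mutual
      -- The weights read letters only through comparisons of neighbours, and these agree for a word
      -- and its code by `rank-descent`.
      weight↑-code : ∀ w → weight↑ (code w) ≡ weight↑ w
      weight↑-code []      = ≡.refl
      weight↑-code (a ∷ w) = ≡.cong₂ (λ u v → σ * (t * (t * u + y * v))) (up-code a w) (down-code a w)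

      weight↓-code : ∀ w → weight↓ (code w) ≡ weight↓ w
      weight↓-code []      = ≡.refl
      weight↓-code (a ∷ w) = ≡.cong₂ (λ u v → σ * (t * (u + t * (y * v)))) (up-code a w) (down-code a w)

      up-code : ∀ a w → up (rank a w) (code w) ≡ up a w
      up-code a []      = ≡.refl
      up-code a (b ∷ w)
        rewrite rank-descent a b w | up-code b w | down-code b w = ≡.refl

      down-code : ∀ a w → down (rank a w) (code w) ≡ down a w
      down-code a []      = ≡.refl
      down-code a (b ∷ w)
        rewrite rank-descent a b w | up-code b w | down-code b w = ≡.refl

    -- The weight of one permutation as a monomial

    module ClosedForm
      (α β γ : Carrier)
      (α-eq : (y + t ^ 2) * (1# + y * t) * α ≈ t * (1# + y) * (y + t))
      (β-eq : (1# + y * t ^ 2) * (y + t) * β ≈ t * (1# + y) * (1# + y * t))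
      (γ-eq : (1# + y * t ^ 2) * γ ≈ y + t ^ 2)
      where

      private
        A = 1# + y * t ^ 2
        B = y + t ^ 2
        M = t * (1# + y)
        X = 1# + y * t
        Z = y + t

      -- Up to σt, `Z` and `X` are the values of `weight↑` and `weight↓` on one letter. Relative to
      -- them, and with `A` taken out, the ascent entries become β and 1 and the descent entries γ
      -- and αγ; the three nontrivial cases are the equations here.
      MX≈AZβ : M * X ≈ A * (Z * β)
      MX≈AZβ = trans (sym β-eq) (*-assoc A Z β)

      BZ≈AZγ : B * Z ≈ A * (Z * γ)
      BZ≈AZγ = begin
        B * Z        ≈⟨ *-congʳ γ-eq ⟨
        A * γ * Z    ≈⟨ solve 3 (λ A γ Z → A :* γ :* Z := A :* (Z :* γ)) refl A γ Z ⟩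
        A * (Z * γ)  ∎

      MZ≈AXαγ : M * Z ≈ A * (X * (α * γ))
      MZ≈AXαγ = begin
        M * Z              ≈⟨ α-eq ⟨
        B * X * α          ≈⟨ *-congʳ (*-congʳ γ-eq) ⟨
        A * γ * X * α      ≈⟨ solve 4 (λ A γ X α → A :* γ :* X :* α := A :* (X :* (α :* γ))) refl A γ X α ⟩
        A * (X * (α * γ))  ∎

      monomial : ℕ → ℕ → ℕ → Carrier
      monomial i j k = α ^ i * β ^ j * γ ^ k

      closed : Carrier → ℕ → Carrier → Carrier
      closed x n g = t * x * (A ^ n * σ ^ suc n) * g

      -- One entry `a` of a transfer matrix: `x` and `z` normalise the old and the new weight, and
      -- `b` is the monomial left over.
      closed-∷ : ∀ {a x b z v v′} n g h → a * x ≈ A * (z * b) → v′ ≈ σ * a * v →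
                 v ≈ closed x n g → b * g ≈ h → v′ ≈ closed z (suc n) h
      closed-∷ {a} {x} {b} {z} {v} {v′} n g h ax≈Azb v′≈ v≈ bg≈h = begin
        v′
          ≈⟨ v′≈ ⟩
        σ * a * v
          ≈⟨ *-congˡ v≈ ⟩
        σ * a * closed x n g
          ≈⟨ solve 7 (λ σ a t x p r g → σ :* a :* (t :* x :* (p :* r) :* g) :=
                                        a :* x :* (σ :* t :* p :* r :* g)) refl σ a t x _ _ g ⟩
        a * x * (σ * t * A ^ n * σ ^ suc n * g)
          ≈⟨ *-congʳ ax≈Azb ⟩
        A * (z * b) * (σ * t * A ^ n * σ ^ suc n * g)
          ≈⟨ solve 8 (λ σ A t z b p r g → A :* (z :* b) :* (σ :* t :* p :* r :* g) :=
                                          t :* z :* ((A :* p) :* (σ :* r)) :* (b :* g))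
               refl σ A t z b _ _ g ⟩
        closed z (suc n) (b * g)
          ≈⟨ *-congˡ bg≈h ⟩
        closed z (suc n) h ∎

      monomial-cong : ∀ {i i′ j j′ k k′} → i ≡ i′ → j ≡ j′ → k ≡ k′ →
                      monomial i j k ≈ monomial i′ j′ k′
      monomial-cong ≡.refl ≡.refl ≡.refl = refl

      -- Prepending a letter multiplies the weights by rank one matrices, so both weights are
      -- monomials; peaks and valleys count the changes of direction.
      weights-closed : ∀ a w → Unique (a ∷ w) → let π = a ∷ w in
        weight↑ π ≈ closed Z (length w) (monomial (interiorPeaks π) (val∞ π) (des π)) ×
        weight↓ π ≈ closed X (length w) (monomial (lpk π) (val π) (des π))
      weights-closed a [] _ =
          solve 3 (λ σ t y → σ :* (t :* (t :* con 1 :+ y :* con 1)) :=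
                             t :* (y :+ t) :* (con 1 :* (σ :* con 1)) :* (con 1 :* con 1 :* con 1))
            refl σ t y
        , solve 3 (λ σ t y → σ :* (t :* (con 1 :+ t :* (y :* con 1))) :=
                             t :* (con 1 :+ y :* t) :* (con 1 :* (σ :* con 1)) :*
                             (con 1 :* con 1 :* con 1))
            refl σ t y
      weights-closed a (b ∷ w) ((a≢b ∷ _) ∷ u) with weights-closed b w u | ℕ.<-cmp a b
      ... | _ | tri≈ _ a≡b _ = contradiction a≡b a≢b
      ... | ih↑ , ih↓ | tri> _ _ b<a =
          closed-∷ (length w) _ _ BZ≈AZγ (weight↑-desc {a} {b} w (<ᵇ-true b<a)) ih↑ (trans
            (solve 4 (λ γ i j k → γ :* (i :* j :* k) := i :* j :* (γ :* k)) refl γ _ _ _)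
            (sym (monomial-cong (interiorPeaks-desc w b<a) (val∞-desc w b<a) (des-desc w b<a))))
        , closed-∷ (length w) _ _ MZ≈AXαγ (weight↓-desc {a} {b} w (<ᵇ-true b<a)) ih↑ (trans
            (solve 5 (λ α γ i j k → α :* γ :* (i :* j :* k) := (α :* i) :* j :* (γ :* k))
               refl α γ _ _ _)
            (sym (monomial-cong (lpk-desc w b<a) (val-desc w b<a) (des-desc w b<a))))
      ... | ih↑ , ih↓ | tri< a<b _ b≮a =
          closed-∷ (length w) _ _ MX≈AZβ (weight↑-asc {a} {b} w (<ᵇ-false b≮a)) ih↓ (trans
            (solve 4 (λ β i j k → β :* (i :* j :* k) := i :* (β :* j) :* k) refl β _ _ _)
            (sym (monomial-cong (interiorPeaks-asc w a<b) (val∞-asc w a<b) (des-asc w a<b))))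
        , closed-∷ (length w) _ _ (*-congˡ (sym (*-identityʳ X)))
                   (weight↓-asc {a} {b} w (<ᵇ-false b≮a)) ih↓ (trans
            (*-identityˡ _)
            (sym (monomial-cong (lpk-asc w a<b) (val-asc w a<b) (des-asc w a<b))))

      -- `weight↓` is the weight of all cuts because the first piece is increasing, as if a
      -- decreasing one had just been closed.
      P-closed : ∀ n →
        t * X * (A ^ n * σ ^ suc n) * P⁽inv,lpk,val,des⁾ R (suc n) q α β γ ≈
        ∑codes (suc n) (λ w → q ^ sum w * weight↓ w)
      P-closed n = begin
        s * ∑ₗ (λ π → q ^ inv π * α ^ lpk π * β ^ val π * γ ^ des π) (𝔖 (suc n))
          ≈⟨ *-distribˡ-∑ₗ s (λ π → q ^ inv π * α ^ lpk π * β ^ val π * γ ^ des π) (𝔖 (suc n)) ⟩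
        ∑ₗ (λ π → s * (q ^ inv π * α ^ lpk π * β ^ val π * γ ^ des π)) (𝔖 (suc n))
          ≈⟨ ∑ₗ-cong (All.zipWith (λ { {π} (len , u) → summand π len u })
                       (𝔖-length (suc n) , 𝔖-unique (suc n))) ⟩
        ∑ₗ ((λ w → q ^ sum w * weight↓ w) ∘ code) (𝔖 (suc n))
          ≈⟨ ∑-𝔖 (suc n) (λ w → q ^ sum w * weight↓ w) ⟩
        ∑codes (suc n) (λ w → q ^ sum w * weight↓ w) ∎
        where
        s = t * X * (A ^ n * σ ^ suc n)
        summand : ∀ π → length π ≡ suc n → Unique π →
                  s * (q ^ inv π * α ^ lpk π * β ^ val π * γ ^ des π) ≈
                  q ^ sum (code π) * weight↓ (code π)
        summand π@(a ∷ w) ≡.refl u = begin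
          s * (q ^ inv π * α ^ lpk π * β ^ val π * γ ^ des π)
            ≈⟨ solve 5 (λ s i l v d → s :* (i :* l :* v :* d) := i :* (s :* (l :* v :* d)))
                 refl s _ _ _ _ ⟩
          q ^ inv π * closed X n (monomial (lpk π) (val π) (des π))
            ≈⟨ *-congˡ (proj₂ (weights-closed a w u)) ⟨
          q ^ inv π * weight↓ π
            ≡⟨ ≡.cong₂ (λ i x → q ^ i * x) (inv-code π) (weight↓-code π) ⟨
          q ^ sum (code π) * weight↓ (code π) ∎

    -- The sum of f over 𝔖ₙ with weight q^inv, in terms of Lehmer codes.
    ⟨_⟩ : (List ℕ → Carrier) → ℕ → Carrier
    ⟨ f ⟩ n = ∑codes n (λ w → q ^ sum w * f w)

    ⟨⟩-cong : ∀ {f g} → (∀ w → f w ≈ g w) → ∀ n → ⟨ f ⟩ n ≈ ⟨ g ⟩ n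
    ⟨⟩-cong h n = ∑codes-cong n λ w → *-congˡ (h w)

    ⟨⟩-scale : ∀ a f n → ⟨ (λ w → a * f w) ⟩ n ≈ a * ⟨ f ⟩ n
    ⟨⟩-scale a f n = trans
      (∑codes-cong n λ w → solve 3 (λ q a x → q :* (a :* x) := a :* (q :* x)) refl _ a (f w))
      (∑codes-* n a (λ w → q ^ sum w * f w))

    ⟨⟩-zero : ∀ n → ⟨ (λ w → 0#) ⟩ n ≈ 0#
    ⟨⟩-zero n = trans
      (⟨⟩-cong {λ w → 0#} {λ w → 0# * 0#} (λ w → sym (zeroˡ 0#)) n)
      (trans (⟨⟩-scale 0# (λ w → 0#) n) (zeroˡ _))

    -- Only `h` is separated from the first digit; `g` keeps the whole word, so its sum remains one
    -- over all codes of length `suc n`.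
    ⟨⟩-suc : ∀ {f g} {h : ℕ → List ℕ → Carrier} → (∀ k w → f (k ∷ w) ≈ g (k ∷ w) + h k w) → ∀ n →
             ⟨ f ⟩ (suc n) ≈ ⟨ g ⟩ (suc n) + ∑[ k < suc n ] (q ^ k * ⟨ h k ⟩ n)
    ⟨⟩-suc {f} {g} {h} eq n = begin
      ⟨ f ⟩ (suc n)
        ≈⟨ ∑-cong (suc n) (λ k → ∑codes-cong n λ w → summand k w) ⟩
      ∑[ k < suc n ] ∑codes n (λ w → q ^ sum (k ∷ w) * g (k ∷ w) + q ^ k * (q ^ sum w * h k w))
        ≈⟨ ∑-cong (suc n) (λ k → trans
             (∑codes-+ n (λ w → q ^ sum (k ∷ w) * g (k ∷ w)) (λ w → q ^ k * (q ^ sum w * h k w)))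
             (+-congˡ (∑codes-* n (q ^ k) (λ w → q ^ sum w * h k w)))) ⟩
      ∑[ k < suc n ] (∑codes n (λ w → q ^ sum (k ∷ w) * g (k ∷ w)) + q ^ k * ⟨ h k ⟩ n)
        ≈⟨ ∑-distrib-+ (suc n) (λ k → ∑codes n (λ w → q ^ sum (k ∷ w) * g (k ∷ w)))
                               (λ k → q ^ k * ⟨ h k ⟩ n) ⟩
      ⟨ g ⟩ (suc n) + ∑[ k < suc n ] (q ^ k * ⟨ h k ⟩ n) ∎
      where
      summand : ∀ k w → q ^ sum (k ∷ w) * f (k ∷ w) ≈
                        q ^ sum (k ∷ w) * g (k ∷ w) + q ^ k * (q ^ sum w * h k w)
      summand k w = begin
        q ^ sum (k ∷ w) * f (k ∷ w)
          ≈⟨ *-congˡ (eq k w) ⟩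
        q ^ sum (k ∷ w) * (g (k ∷ w) + h k w)
          ≈⟨ distribˡ _ _ _ ⟩
        q ^ sum (k ∷ w) * g (k ∷ w) + q ^ sum (k ∷ w) * h k w
          ≈⟨ +-congˡ (trans (*-congʳ (^-homo-* q k (sum w))) (*-assoc _ _ _)) ⟩
        q ^ sum (k ∷ w) * g (k ∷ w) + q ^ k * (q ^ sum w * h k w) ∎

    -- Recursions for the weights summed over codes

    q^⟨up⟩ q^⟨down⟩ : ℕ → ℕ → Carrier
    q^⟨up⟩   n k = q ^ k * ⟨ up k ⟩ n
    q^⟨down⟩ n k = q ^ k * (y * ⟨ down k ⟩ n)

    ⟨up⟩-suc : ∀ n k → ⟨ up k ⟩ (suc n) ≈ ⟨ weight↑ ⟩ (suc n) + ∑[ j < suc n ] above k (q^⟨up⟩ n) j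
    ⟨up⟩-suc n k = trans
      (⟨⟩-suc {up k} {weight↑} {λ j w → above k (λ b → up b w) j} (λ _ _ → refl) n)
      (+-congˡ (∑-cong (suc n) summand))
      where
      summand : ∀ j → q ^ j * ⟨ (λ w → above k (λ b → up b w) j) ⟩ n ≈ above k (q^⟨up⟩ n) j
      summand j with j <ᵇ k
      ... | true  = trans (*-congˡ (⟨⟩-zero n)) (zeroʳ _)
      ... | false = refl

    ⟨down⟩-suc : ∀ n k →
      ⟨ down k ⟩ (suc n) ≈ ⟨ weight↓ ⟩ (suc n) + ∑[ j < suc n ] below k (q^⟨down⟩ n) j
    ⟨down⟩-suc n k = trans
      (⟨⟩-suc {down k} {weight↓} {λ j w → below k (λ b → y * down b w) j} (λ _ _ → refl) n)
      (+-congˡ (∑-cong (suc n) summand))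
      where
      summand : ∀ j → q ^ j * ⟨ (λ w → below k (λ b → y * down b w) j) ⟩ n ≈ below k (q^⟨down⟩ n) j
      summand j with j <ᵇ k
      ... | true  = *-congˡ (⟨⟩-scale y (down j) n)
      ... | false = trans (*-congˡ (⟨⟩-zero n)) (zeroʳ _)

    -- Separates the continuation by the digit `k` itself, after which the threshold is unchanged
    -- and one letter fewer remains.
    ⟨up⟩-step : ∀ k r → ⟨ up k ⟩ (suc (k ℕ.+ r)) ≈
                        ⟨ up (suc k) ⟩ (suc (k ℕ.+ r)) + q ^ k * ⟨ up k ⟩ (k ℕ.+ r)
    ⟨up⟩-step k r = begin
      ⟨ up k ⟩ (suc n)
        ≈⟨ ⟨up⟩-suc n k ⟩
      ⟨ weight↑ ⟩ (suc n) + ∑[ j < suc n ] above k (q^⟨up⟩ n) j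
        ≈⟨ +-congˡ (∑-above-suc k r (q^⟨up⟩ n)) ⟩
      ⟨ weight↑ ⟩ (suc n) + (∑[ j < suc n ] above (suc k) (q^⟨up⟩ n) j + q^⟨up⟩ n k)
        ≈⟨ +-assoc _ _ _ ⟨
      ⟨ weight↑ ⟩ (suc n) + ∑[ j < suc n ] above (suc k) (q^⟨up⟩ n) j + q^⟨up⟩ n k
        ≈⟨ +-congʳ (⟨up⟩-suc n (suc k)) ⟨
      ⟨ up (suc k) ⟩ (suc n) + q^⟨up⟩ n k ∎
      where n = k ℕ.+ r

    -- All digits of a code of length n are below n, so the piece cannot be continued.
    ⟨up⟩-diagonal : ∀ n → ⟨ up n ⟩ n ≈ ⟨ weight↑ ⟩ n
    ⟨up⟩-diagonal zero    = refl
    ⟨up⟩-diagonal (suc n) = begin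
      ⟨ up (suc n) ⟩ (suc n)
        ≈⟨ ⟨up⟩-suc n (suc n) ⟩
      ⟨ weight↑ ⟩ (suc n) + ∑[ j < suc n ] above (suc n) (q^⟨up⟩ n) j
        ≈⟨ +-congˡ (∑-above-all (suc n) (q^⟨up⟩ n)) ⟩
      ⟨ weight↑ ⟩ (suc n) + 0#
        ≈⟨ +-identityʳ _ ⟩
      ⟨ weight↑ ⟩ (suc n) ∎

    ⟨down⟩-step : ∀ k r → ⟨ down (suc k) ⟩ (suc (k ℕ.+ r)) ≈
                          ⟨ down k ⟩ (suc (k ℕ.+ r)) + q ^ k * (y * ⟨ down k ⟩ (k ℕ.+ r))
    ⟨down⟩-step k r = begin
      ⟨ down (suc k) ⟩ (suc n)
        ≈⟨ ⟨down⟩-suc n (suc k) ⟩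
      ⟨ weight↓ ⟩ (suc n) + ∑[ j < suc n ] below (suc k) (q^⟨down⟩ n) j
        ≈⟨ +-congˡ (∑-below-suc k r (q^⟨down⟩ n)) ⟩
      ⟨ weight↓ ⟩ (suc n) + (∑[ j < suc n ] below k (q^⟨down⟩ n) j + q^⟨down⟩ n k)
        ≈⟨ +-assoc _ _ _ ⟨
      ⟨ weight↓ ⟩ (suc n) + ∑[ j < suc n ] below k (q^⟨down⟩ n) j + q^⟨down⟩ n k
        ≈⟨ +-congʳ (⟨down⟩-suc n k) ⟨
      ⟨ down k ⟩ (suc n) + q^⟨down⟩ n k ∎
      where n = k ℕ.+ r

    ⟨down⟩-zero : ∀ n → ⟨ down 0 ⟩ n ≈ ⟨ weight↓ ⟩ n
    ⟨down⟩-zero zero    = refl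
    ⟨down⟩-zero (suc n) = begin
      ⟨ down 0 ⟩ (suc n)
        ≈⟨ ⟨down⟩-suc n 0 ⟩
      ⟨ weight↓ ⟩ (suc n) + ∑[ j < suc n ] below 0 (q^⟨down⟩ n) j
        ≈⟨ +-congˡ (∑-zero (suc n) {below 0 (q^⟨down⟩ n)} λ _ → refl) ⟩
      ⟨ weight↓ ⟩ (suc n) + 0#
        ≈⟨ +-identityʳ _ ⟩
      ⟨ weight↓ ⟩ (suc n) ∎

    -- A fictitious preceding digit 0 puts no restriction on the next one, so a fresh increasing
    -- piece is the continuation of a piece ending in 0. On the empty word the two sides would be 1
    -- and t.
    ⟨weight↓⟩-suc : ∀ n → ⟨ weight↓ ⟩ (suc n) ≈ t * ⟨ up 0 ⟩ (suc n)
    ⟨weight↓⟩-suc n = begin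
      ⟨ weight↓ ⟩ (suc n)
        ≈⟨ ⟨⟩-suc {weight↓} {λ w → t * weight↑ w} {λ k w → t * up k w} weight↓-∷ n ⟩
      ⟨ (λ w → t * weight↑ w) ⟩ (suc n) + ∑[ k < suc n ] (q ^ k * ⟨ (λ w → t * up k w) ⟩ n)
        ≈⟨ +-cong (⟨⟩-scale t weight↑ (suc n)) (∑-cong (suc n) λ k → trans
             (*-congˡ (⟨⟩-scale t (up k) n))
             (solve 3 (λ p t x → p :* (t :* x) := t :* (p :* x)) refl (q ^ k) t _)) ⟩
      t * ⟨ weight↑ ⟩ (suc n) + ∑[ k < suc n ] (t * q^⟨up⟩ n k)
        ≈⟨ +-congˡ (*-distribˡ-∑ (suc n) t (q^⟨up⟩ n)) ⟨
      t * ⟨ weight↑ ⟩ (suc n) + t * ∑[ k < suc n ] q^⟨up⟩ n k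
        ≈⟨ distribˡ _ _ _ ⟨
      t * (⟨ weight↑ ⟩ (suc n) + ∑[ k < suc n ] q^⟨up⟩ n k)
        ≈⟨ *-congˡ (⟨up⟩-suc n 0) ⟨
      t * ⟨ up 0 ⟩ (suc n) ∎

    -- Here the fictitious digit is `suc n`, which exceeds every digit of the code.
    ⟨weight↑⟩-suc : ∀ n → ⟨ weight↑ ⟩ (suc n) ≈ t * ⟨ down (suc n) ⟩ (suc n)
    ⟨weight↑⟩-suc n = begin
      ⟨ weight↑ ⟩ (suc n)
        ≈⟨ ⟨⟩-suc {weight↑} {λ w → t * weight↓ w} {λ k w → t * (y * down k w)} weight↑-∷ n ⟩
      ⟨ (λ w → t * weight↓ w) ⟩ (suc n) + ∑[ k < suc n ] (q ^ k * ⟨ (λ w → t * (y * down k w)) ⟩ n)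
        ≈⟨ +-cong (⟨⟩-scale t weight↓ (suc n)) (∑-cong (suc n) λ k → trans
             (*-congˡ (trans (⟨⟩-scale t (λ w → y * down k w) n) (*-congˡ (⟨⟩-scale y (down k) n))))
             (solve 3 (λ p t x → p :* (t :* x) := t :* (p :* x)) refl (q ^ k) t _)) ⟩
      t * ⟨ weight↓ ⟩ (suc n) + ∑[ k < suc n ] (t * q^⟨down⟩ n k)
        ≈⟨ +-congˡ (*-distribˡ-∑ (suc n) t (q^⟨down⟩ n)) ⟨
      t * ⟨ weight↓ ⟩ (suc n) + t * ∑[ k < suc n ] q^⟨down⟩ n k
        ≈⟨ distribˡ _ _ _ ⟨
      t * (⟨ weight↓ ⟩ (suc n) + ∑[ k < suc n ] q^⟨down⟩ n k)
        ≈⟨ *-congˡ (+-congˡ (∑-below-all (suc n) (q^⟨down⟩ n))) ⟨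
      t * (⟨ weight↓ ⟩ (suc n) + ∑[ k < suc n ] below (suc n) (q^⟨down⟩ n) k)
        ≈⟨ *-congˡ (⟨down⟩-suc n (suc n)) ⟨
      t * ⟨ down (suc n) ⟩ (suc n) ∎

    -- The piece goes on for m digits k ≤ b₁ ≤ ⋯ ≤ bₘ ≤ N-m; the last bound implies the code bounds
    -- on the earlier digits. Such sequences have generating function q^(km) times the q-binomial of
    -- r and m, and an arbitrary code of length N-m follows.
    ⟨up⟩-closed : ∀ r k N → k ℕ.+ r ≡ N →
      ⟨ up k ⟩ N ≈ ∑[ m < suc r ] (qbinom r m * (q ^ (k ℕ.* m) * ⟨ weight↑ ⟩ (N ∸ m)))
    ⟨up⟩-closed zero k N ≡.refl rewrite ℕ.+-identityʳ k | ℕ.*-zeroʳ k =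
      trans (⟨up⟩-diagonal k)
            (solve 1 (λ x → x := con 1 :* (con 1 :* x) :+ con 0) refl (⟨ weight↑ ⟩ k))
    ⟨up⟩-closed (suc r) k N ≡.refl rewrite ℕ.+-suc k r = begin
      ⟨ up k ⟩ (suc (k ℕ.+ r))
        ≈⟨ ⟨up⟩-step k r ⟩
      ⟨ up (suc k) ⟩ (suc (k ℕ.+ r)) + q ^ k * ⟨ up k ⟩ (k ℕ.+ r)
        ≈⟨ +-cong (⟨up⟩-closed r (suc k) (suc (k ℕ.+ r)) ≡.refl)
                  (*-congˡ (⟨up⟩-closed r k (k ℕ.+ r) ≡.refl)) ⟩
      ∑[ m < suc r ] (qbinom r m * (q ^ (suc k ℕ.* m) * ⟨ weight↑ ⟩ (suc (k ℕ.+ r) ∸ m))) +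
      q ^ k * ∑[ m < suc r ] g m
        ≈⟨ +-cong (∑-cong (suc r) unshifted)
                  (trans (*-distribˡ-∑ (suc r) (q ^ k) g) (∑-cong (suc r) shifted)) ⟩
      ∑[ m < suc r ] (qbinom r m * (q ^ m * f m)) + ∑[ m < suc r ] (qbinom r m * f (suc m))
        ≈⟨ ∑-qbinom-suc r f ⟨
      ∑[ m < suc (suc r) ] (qbinom (suc r) m * f m) ∎
      where
      f g : ℕ → Carrier
      f m = q ^ (k ℕ.* m) * ⟨ weight↑ ⟩ (suc (k ℕ.+ r) ∸ m)
      g m = qbinom r m * (q ^ (k ℕ.* m) * ⟨ weight↑ ⟩ (k ℕ.+ r ∸ m))

      unshifted : ∀ m → qbinom r m * (q ^ (suc k ℕ.* m) * ⟨ weight↑ ⟩ (suc (k ℕ.+ r) ∸ m)) ≈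
                        qbinom r m * (q ^ m * f m)
      unshifted m = *-congˡ (trans (*-congʳ (^-homo-* q m (k ℕ.* m))) (*-assoc _ _ _))

      shifted : ∀ m → q ^ k * g m ≈ qbinom r m * f (suc m)
      shifted m = begin
        q ^ k * (qbinom r m * (q ^ (k ℕ.* m) * ⟨ weight↑ ⟩ (k ℕ.+ r ∸ m)))
          ≈⟨ solve 4 (λ p b s x → p :* (b :* (s :* x)) := b :* (p :* s :* x))
               refl (q ^ k) (qbinom r m) (q ^ (k ℕ.* m)) _ ⟩
        qbinom r m * (q ^ k * q ^ (k ℕ.* m) * ⟨ weight↑ ⟩ (k ℕ.+ r ∸ m))
          ≈⟨ *-congˡ (*-congʳ (trans (reflexive (≡.cong (q ^_) (ℕ.*-suc k m)))
                                     (^-homo-* q k (k ℕ.* m)))) ⟨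
        qbinom r m * f (suc m) ∎

    -- The piece goes on for m digits k > b₁ > ⋯ > bₘ ≥ 0, which obey the code bounds because k ≤ N.
    -- The least possible digits m-1, ..., 0 account for the exponent `m C 2`.
    ⟨down⟩-closed : ∀ k r N → k ℕ.+ r ≡ N →
      ⟨ down k ⟩ N ≈ ∑[ m < suc k ] (qbinom k m * (q ^ (m C 2) * (y ^ m * ⟨ weight↓ ⟩ (N ∸ m))))
    ⟨down⟩-closed zero r N ≡.refl =
      trans (⟨down⟩-zero r)
            (solve 1 (λ x → x := con 1 :* (con 1 :* (con 1 :* x)) :+ con 0) refl (⟨ weight↓ ⟩ r))
    ⟨down⟩-closed (suc k) r N ≡.refl = begin
      ⟨ down (suc k) ⟩ (suc (k ℕ.+ r))
        ≈⟨ ⟨down⟩-step k r ⟩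
      ⟨ down k ⟩ (suc (k ℕ.+ r)) + q ^ k * (y * ⟨ down k ⟩ (k ℕ.+ r))
        ≈⟨ +-cong (⟨down⟩-closed k (suc r) (suc (k ℕ.+ r)) (ℕ.+-suc k r))
                  (*-congˡ (*-congˡ (⟨down⟩-closed k r (k ℕ.+ r) ≡.refl))) ⟩
      ∑[ m < suc k ] (qbinom k m * (q ^ (m C 2) * f m)) +
      q ^ k * (y * ∑[ m < suc k ] g m)
        ≈⟨ +-congˡ (*-congˡ (trans (*-distribˡ-∑ (suc k) y g) (∑-cong (suc k) λ m →
             solve 5 (λ y b e p x → y :* (b :* (e :* (p :* x))) := b :* (e :* (y :* p :* x)))
               refl y (qbinom k m) (q ^ (m C 2)) (y ^ m) (⟨ weight↓ ⟩ (k ℕ.+ r ∸ m))))) ⟩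
      ∑[ m < suc k ] (qbinom k m * (q ^ (m C 2) * f m)) +
      q ^ k * ∑[ m < suc k ] (qbinom k m * (q ^ (m C 2) * f (suc m)))
        ≈⟨ ∑-qbinom-suc′ k f ⟨
      ∑[ m < suc (suc k) ] (qbinom (suc k) m * (q ^ (m C 2) * f m)) ∎
      where
      f g : ℕ → Carrier
      g m = qbinom k m * (q ^ (m C 2) * (y ^ m * ⟨ weight↓ ⟩ (k ℕ.+ r ∸ m)))
      f m = y ^ m * ⟨ weight↓ ⟩ (suc (k ℕ.+ r) ∸ m)

-- Generating functions

module LinearSystem (R : CommutativeRing c ℓ) where
  open CommutativeRing R
  open RingProperties ring using (-‿distribʳ-*)
  open SemiringSolver commutativeSemiring using (solve; con; _:+_; _:*_; _:=_)
  open SetoidReasoning setoid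

  -- Substitution solves the system without dividing. `τ²` is separate from `τ * τ` to accommodate
  -- the constant series of t².
  eliminate : ∀ {p τ τ² e E C D} → D ≈ p + τ * (e * C) → C ≈ p + τ * (E * D) → τ² ≈ τ * τ →
              D * (1# - τ² * e * E) ≈ p * (1# + τ * e)
  eliminate {p} {τ} {τ²} {e} {E} {C} {D} D≈ C≈ τ²≈ = begin
    D * (1# - τ² * e * E)
      ≈⟨ distribˡ D _ _ ⟩
    D * 1# + D * - (τ² * e * E)
      ≈⟨ +-cong (*-identityʳ D) (sym (-‿distribʳ-* D _)) ⟩
    D - D * (τ² * e * E)
      ≈⟨ +-congʳ (begin
           D
             ≈⟨ D≈ ⟩
           p + τ * (e * C)
             ≈⟨ +-congˡ (*-congˡ (*-congˡ C≈)) ⟩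
           p + τ * (e * (p + τ * (E * D)))
             ≈⟨ solve 5 (λ p τ e E D → p :+ τ :* (e :* (p :+ τ :* (E :* D))) :=
                                       p :* (con 1 :+ τ :* e) :+ D :* (τ :* τ :* e :* E))
                  refl p τ e E D ⟩
           p * (1# + τ * e) + D * (τ * τ * e * E)
             ≈⟨ +-congˡ (*-congˡ (*-congʳ (*-congʳ τ²≈))) ⟨
           p * (1# + τ * e) + D * (τ² * e * E) ∎) ⟩
    p * (1# + τ * e) + D * (τ² * e * E) - D * (τ² * e * E)
      ≈⟨ +-assoc _ _ _ ⟩
    p * (1# + τ * e) + (D * (τ² * e * E) - D * (τ² * e * E))
      ≈⟨ +-congˡ (-‿inverseʳ _) ⟩
    p * (1# + τ * e) + 0#
      ≈⟨ +-identityʳ _ ⟩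
    p * (1# + τ * e) ∎

module FieldProperties (F : DecField c ℓ) where
  open DecField F hiding (zero)
  open SemiringExp semiring using (_^_)
  open SemiringSolver commutativeSemiring using (solve; con; _:+_; _:*_; _:=_)
  open SetoidReasoning setoid

  *-≉0 : ∀ {x z} → ¬ (x ≈ 0#) → ¬ (z ≈ 0#) → ¬ (x * z ≈ 0#)
  *-≉0 {x} {z} x≉0 z≉0 xz≈0 = z≉0 (begin
    z               ≈⟨ *-identityˡ z ⟨
    1# * z          ≈⟨ *-congʳ (⁻¹-inverseʳ x x≉0) ⟨
    x * x ⁻¹ * z    ≈⟨ solve 3 (λ x i z → x :* i :* z := i :* (x :* z)) refl x (x ⁻¹) z ⟩
    x ⁻¹ * (x * z)  ≈⟨ *-congˡ xz≈0 ⟩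
    x ⁻¹ * 0#       ≈⟨ zeroʳ _ ⟩
    0#              ∎)

  ⁻¹-unique : ∀ {x z} → x * z ≈ 1# → x ⁻¹ ≈ z
  ⁻¹-unique {x} {z} xz≈1 = begin
    x ⁻¹            ≈⟨ *-identityʳ _ ⟨
    x ⁻¹ * 1#       ≈⟨ *-congˡ xz≈1 ⟨
    x ⁻¹ * (x * z)  ≈⟨ solve 3 (λ x i z → i :* (x :* z) := x :* i :* z) refl x (x ⁻¹) z ⟩
    x * x ⁻¹ * z    ≈⟨ *-congʳ (⁻¹-inverseʳ x λ x≈0 →
                         1≉0 (trans (sym xz≈1) (trans (*-congʳ x≈0) (zeroˡ z)))) ⟩
    1# * z          ≈⟨ *-identityˡ z ⟩
    z               ∎

  *-/-cancel : ∀ {x} a → ¬ (x ≈ 0#) → x * (a / x) ≈ a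
  *-/-cancel {x} a x≉0 = begin
    x * (a * x ⁻¹)  ≈⟨ solve 3 (λ x a i → x :* (a :* i) := a :* (x :* i)) refl x a (x ⁻¹) ⟩
    a * (x * x ⁻¹)  ≈⟨ *-congˡ (⁻¹-inverseʳ x x≉0) ⟩
    a * 1#          ≈⟨ *-identityʳ a ⟩
    a               ∎

  ^-⁻¹ : ∀ {x} → ¬ (x ≈ 0#) → ∀ n → (x ^ n) ⁻¹ ≈ (x ⁻¹) ^ n
  ^-⁻¹ {x} x≉0 n = ⁻¹-unique (inverse n)
    where
    inverse : ∀ n → x ^ n * (x ⁻¹) ^ n ≈ 1#
    inverse zero    = *-identityˡ 1#
    inverse (suc n) = begin
      x * x ^ n * (x ⁻¹ * (x ⁻¹) ^ n)
        ≈⟨ solve 4 (λ x p i r → x :* p :* (i :* r) := x :* i :* (p :* r)) refl x (x ^ n) (x ⁻¹) _ ⟩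
      x * x ⁻¹ * (x ^ n * (x ⁻¹) ^ n)
        ≈⟨ *-cong (⁻¹-inverseʳ x x≉0) (inverse n) ⟩
      1# * 1#
        ≈⟨ *-identityˡ 1# ⟩
      1# ∎

-- The identity over a field in which the denominators do not vanish

module _ (F : DecField c ℓ) where
  open DecField F hiding (zero)
  open SemiringExp semiring using (_^_)

  module GeneratingFunction
    (q y t : Carrier)
    (⟦_⟧ ⟦_⟧! : ℕ → Carrier)
    (⟦0⟧ : ⟦ 0 ⟧ ≈ 0#) (⟦suc⟧ : ∀ n → ⟦ suc n ⟧ ≈ ⟦ n ⟧ + q ^ n)
    (⟦0⟧! : ⟦ 0 ⟧! ≈ 1#) (⟦suc⟧! : ∀ n → ⟦ suc n ⟧! ≈ ⟦ n ⟧! * ⟦ suc n ⟧)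
    (⟦suc⟧≉0 : ∀ n → ¬ (⟦ suc n ⟧ ≈ 0#))
    (1-t²≉0 : ¬ (1# - t ^ 2 ≈ 0#))
    (1+yt²≉0 : ¬ (1# + y * t ^ 2 ≈ 0#))
    (y+t²≉0 : ¬ (y + t ^ 2 ≈ 0#))
    (1+yt≉0 : ¬ (1# + y * t ≈ 0#))
    (y+t≉0 : ¬ (y + t ≈ 0#))
    where
    open SeriesDivision F
    open FieldProperties F
    open Sums commutativeRing
    open QBinomial commutativeRing q
    open Factorial ⟦_⟧ ⟦_⟧! ⟦0⟧ ⟦suc⟧ ⟦0⟧! ⟦suc⟧!
    open SemiringSolver commutativeSemiring using (solve; con; _:+_; _:*_; _:=_)
    open SetoidReasoning setoid
    private module S = CommutativeRing seriesRing

    α β γ σ : Carrier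
    α = (t * (1# + y) * (y + t)) / ((y + t ^ 2) * (1# + y * t))
    β = (t * (1# + y) * (1# + y * t)) / ((1# + y * t ^ 2) * (y + t))
    γ = (y + t ^ 2) / (1# + y * t ^ 2)
    σ = (1# - t ^ 2) ⁻¹

    1-x+x*1≈1 : ∀ x → (1# - x) + x * 1# ≈ 1#
    1-x+x*1≈1 x = begin
      1# - x + x * 1#  ≈⟨ +-congˡ (*-identityʳ x) ⟩
      1# - x + x       ≈⟨ +-assoc _ _ _ ⟩
      1# + (- x + x)   ≈⟨ +-congˡ (-‿inverseˡ x) ⟩
      1# + 0#          ≈⟨ +-identityʳ 1# ⟩
      1#               ∎

    σ-unfold : σ ≈ 1# + t * t * σ
    σ-unfold = begin
      σ
        ≈⟨ *-identityˡ σ ⟨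
      1# * σ
        ≈⟨ *-congʳ (1-x+x*1≈1 (t ^ 2)) ⟨
      (1# - t ^ 2 + t ^ 2 * 1#) * σ
        ≈⟨ distribʳ σ _ _ ⟩
      (1# - t ^ 2) * σ + t ^ 2 * 1# * σ
        ≈⟨ +-cong (⁻¹-inverseʳ _ 1-t²≉0)
                  (solve 2 (λ t σ → t :* (t :* con 1) :* con 1 :* σ := t :* t :* σ) refl t σ) ⟩
      1# + t * t * σ ∎

    open Weights commutativeRing q y t σ σ-unfold
    open ClosedForm α β γ
      (*-/-cancel _ (*-≉0 y+t²≉0 1+yt≉0))
      (*-/-cancel _ (*-≉0 1+yt²≉0 y+t≉0))
      (*-/-cancel _ 1+yt²≉0)

    ⟦⟧!≉0 : ∀ n → ¬ (⟦ n ⟧! ≈ 0#)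
    ⟦⟧!≉0 zero    eq = 1≉0 (trans (sym ⟦0⟧!) eq)
    ⟦⟧!≉0 (suc n) eq = *-≉0 (⟦⟧!≉0 n) (⟦suc⟧≉0 n) (trans (sym (⟦suc⟧! n)) eq)

    exp-q Exp-q : Series
    exp-q n = 1# / ⟦ n ⟧!
    Exp-q n = q ^ (n C 2) / ⟦ n ⟧!

    egf : (ℕ → Carrier) → Series
    egf a n = a n * exp-q n

    exp-q-0 : exp-q 0 ≈ 1#
    exp-q-0 = trans (*-identityˡ _) (⁻¹-unique (trans (*-identityʳ _) ⟦0⟧!))

    qbinom-exp-q : ∀ m n → qbinom (m ℕ.+ n) m * exp-q (m ℕ.+ n) ≈ exp-q m * exp-q n
    qbinom-exp-q m n = begin
      b * (1# * N!⁻¹)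
        ≈⟨ solve 2 (λ b i → b :* (con 1 :* i) := b :* con 1 :* con 1 :* i) refl b N!⁻¹ ⟩
      b * 1# * 1# * N!⁻¹
        ≈⟨ *-congʳ (*-cong (*-congˡ (⁻¹-inverseʳ _ (⟦⟧!≉0 m))) (⁻¹-inverseʳ _ (⟦⟧!≉0 n))) ⟨
      b * (⟦ m ⟧! * ⟦ m ⟧! ⁻¹) * (⟦ n ⟧! * ⟦ n ⟧! ⁻¹) * N!⁻¹
        ≈⟨ solve 6 (λ b x i z j k → b :* (x :* i) :* (z :* j) :* k :=
                                    b :* (x :* z) :* k :* ((con 1 :* i) :* (con 1 :* j)))
             refl b ⟦ m ⟧! (⟦ m ⟧! ⁻¹) ⟦ n ⟧! (⟦ n ⟧! ⁻¹) N!⁻¹ ⟩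
      b * (⟦ m ⟧! * ⟦ n ⟧!) * N!⁻¹ * (exp-q m * exp-q n)
        ≈⟨ *-congʳ (trans (*-congʳ (qbinom-! m n)) (⁻¹-inverseʳ _ (⟦⟧!≉0 (m ℕ.+ n)))) ⟩
      1# * (exp-q m * exp-q n)
        ≈⟨ *-identityˡ _ ⟩
      exp-q m * exp-q n ∎
      where b = qbinom (m ℕ.+ n) m ; N!⁻¹ = ⟦ m ℕ.+ n ⟧! ⁻¹

    -- The q-analogue of the product rule for exponential generating functions.
    egf-* : ∀ (a b : ℕ → Carrier) N →
            (∑[ m < suc N ] (qbinom N m * (a m * b (N ∸ m)))) * exp-q N ≈ (egf a *ₛ egf b) N
    egf-* a b N = begin
      (∑[ m < suc N ] (qbinom N m * (a m * b (N ∸ m)))) * exp-q N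
        ≈⟨ *-comm _ _ ⟩
      exp-q N * (∑[ m < suc N ] (qbinom N m * (a m * b (N ∸ m))))
        ≈⟨ *-distribˡ-∑ (suc N) (exp-q N) (λ m → qbinom N m * (a m * b (N ∸ m))) ⟩
      ∑[ m < suc N ] (exp-q N * (qbinom N m * (a m * b (N ∸ m))))
        ≈⟨ ∑-cong-< (suc N) (λ { m (s≤s m≤N) → summand m (N ∸ m) (ℕ.m+[n∸m]≡n m≤N) }) ⟩
      (egf a *ₛ egf b) N ∎
      where
      summand : ∀ m n → m ℕ.+ n ≡ N →
                exp-q N * (qbinom N m * (a m * b n)) ≈ egf a m * egf b n
      summand m n ≡.refl = begin
        exp-q N * (qbinom N m * (a m * b n))
          ≈⟨ solve 4 (λ k c x z → k :* (c :* (x :* z)) := c :* k :* (x :* z))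
               refl (exp-q N) (qbinom N m) (a m) (b n) ⟩
        qbinom N m * exp-q N * (a m * b n)
          ≈⟨ *-congʳ (qbinom-exp-q m n) ⟩
        exp-q m * exp-q n * (a m * b n)
          ≈⟨ solve 4 (λ i j x z → i :* j :* (x :* z) := x :* i :* (z :* j))
               refl (exp-q m) (exp-q n) (a m) (b n) ⟩
        egf a m * egf b n ∎

    const-* : ∀ a f n → (const a *ₛ f) n ≈ a * f n
    const-* a f n = begin
      (const a *ₛ f) n
        ≈⟨ *ₛ-cong {const a} {λ m → a * 1ₛ m} {f}
             (λ { zero → sym (*-identityʳ a) ; (suc m) → sym (zeroʳ a) }) (λ _ → refl) n ⟩
      ((λ m → a * 1ₛ m) *ₛ f) n
        ≈⟨ *ₛ-scaleˡ a 1ₛ f n ⟩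
      a * (1ₛ *ₛ f) n
        ≈⟨ *-congˡ (*ₛ-identityˡ f n) ⟩
      a * f n ∎

    -- The recursions for nonempty words are off by 1-t on the empty word, and this defect is the
    -- constant term of the linear system. `1# * 1#` is what `⟨_⟩` gives there.
    egf-start : egf (λ _ → 1# * 1#) 0 ≈ (1# - t) + t * egf (λ _ → 1# * 1#) 0
    egf-start = begin
      1# * 1# * exp-q 0                   ≈⟨ one ⟩
      1#                                  ≈⟨ 1-x+x*1≈1 t ⟨
      (1# - t) + t * 1#                   ≈⟨ +-congˡ (*-congˡ one) ⟨
      (1# - t) + t * (1# * 1# * exp-q 0)  ∎
      where
      one : 1# * 1# * exp-q 0 ≈ 1#
      one = trans (*-cong (*-identityˡ 1#) exp-q-0) (*-identityˡ 1#)

    Ŵ↑ Ŵ↓ : Series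
    Ŵ↑ = egf ⟨ weight↑ ⟩
    Ŵ↓ = egf ⟨ weight↓ ⟩

    Ŵ↓-eq : Ŵ↓ ≈ₛ const (1# - t) +ₛ const t *ₛ (exp-q *ₛ Ŵ↑)
    Ŵ↓-eq n = begin
      Ŵ↓ n
        ≈⟨ unfold n ⟩
      const (1# - t) n + t * (⟨ up 0 ⟩ n * exp-q n)
        -- At k = 0 the power of q is 1, so the q-binomials convolve with the constant sequence 1,
        -- that is, with `exp-q`.
        ≈⟨ +-congˡ (*-congˡ (trans (*-congʳ (⟨up⟩-closed n 0 n ≡.refl))
                                   (egf-* (λ _ → 1#) ⟨ weight↑ ⟩ n))) ⟩
      const (1# - t) n + t * (egf (λ _ → 1#) *ₛ Ŵ↑) n
        ≈⟨ +-congˡ (*-congˡ (*ₛ-cong {g = Ŵ↑} (λ m → *-identityˡ (exp-q m)) (λ _ → refl) n)) ⟩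
      const (1# - t) n + t * (exp-q *ₛ Ŵ↑) n
        ≈⟨ +-congˡ (const-* t (exp-q *ₛ Ŵ↑) n) ⟨
      (const (1# - t) +ₛ const t *ₛ (exp-q *ₛ Ŵ↑)) n ∎
      where
      unfold : ∀ n → Ŵ↓ n ≈ const (1# - t) n + t * (⟨ up 0 ⟩ n * exp-q n)
      unfold zero = egf-start
      unfold (suc n) = trans (*-congʳ (⟨weight↓⟩-suc n)) (trans (*-assoc _ _ _) (sym (+-identityˡ _)))

    Ŵ↑-eq : Ŵ↑ ≈ₛ const (1# - t) +ₛ const t *ₛ (rescale y Exp-q *ₛ Ŵ↓)
    Ŵ↑-eq n = begin
      Ŵ↑ n
        ≈⟨ unfold n ⟩
      const (1# - t) n + t * (⟨ down n ⟩ n * exp-q n)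
        -- At k = n the upper index of the q-binomial is the full length, as the product rule
        -- demands.
        ≈⟨ +-congˡ (*-congˡ (trans
             (*-congʳ (trans (⟨down⟩-closed n 0 n (ℕ.+-identityʳ n))
                             (∑-cong (suc n) λ m → *-congˡ {qbinom n m} (sym
                               (*-assoc (q ^ (m C 2)) (y ^ m) (⟨ weight↓ ⟩ (n ∸ m)))))))
             (egf-* (λ m → q ^ (m C 2) * y ^ m) ⟨ weight↓ ⟩ n))) ⟩
      const (1# - t) n + t * (egf (λ m → q ^ (m C 2) * y ^ m) *ₛ Ŵ↓) n
        ≈⟨ +-congˡ (*-congˡ (*ₛ-cong {g = Ŵ↓} egf≈ (λ _ → refl) n)) ⟩
      const (1# - t) n + t * (rescale y Exp-q *ₛ Ŵ↓) n
        ≈⟨ +-congˡ (const-* t (rescale y Exp-q *ₛ Ŵ↓) n) ⟨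
      (const (1# - t) +ₛ const t *ₛ (rescale y Exp-q *ₛ Ŵ↓)) n ∎
      where
      egf≈ : egf (λ m → q ^ (m C 2) * y ^ m) ≈ₛ rescale y Exp-q
      egf≈ m = solve 3 (λ p r i → p :* r :* (con 1 :* i) := r :* (p :* i))
                 refl (q ^ (m C 2)) (y ^ m) (⟦ m ⟧! ⁻¹)

      unfold : ∀ n → Ŵ↑ n ≈ const (1# - t) n + t * (⟨ down n ⟩ n * exp-q n)
      unfold zero = egf-start
      unfold (suc n) = trans (*-congʳ (⟨weight↑⟩-suc n)) (trans (*-assoc _ _ _) (sym (+-identityˡ _)))

    numerator denominator : Series
    numerator   = const (1# - t) *ₛ (1ₛ +ₛ const t *ₛ exp-q)
    denominator = 1ₛ -ₛ const (t ^ 2) *ₛ exp-q *ₛ rescale y Exp-q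

    Ŵ↓*denominator : Ŵ↓ *ₛ denominator ≈ₛ numerator
    Ŵ↓*denominator = LinearSystem.eliminate seriesRing
      {const (1# - t)} {const t} {const (t ^ 2)} {exp-q} {rescale y Exp-q} {Ŵ↑} {Ŵ↓}
      Ŵ↓-eq Ŵ↑-eq t²≈
      where
      t²≈ : const (t ^ 2) ≈ₛ const t *ₛ const t
      t²≈ zero    = trans (*-congˡ (*-identityʳ t)) (sym (const-* t (const t) 0))
      t²≈ (suc n) = trans (sym (zeroʳ t)) (sym (const-* t (const t) (suc n)))

    denominator₀≉0 : ¬ (denominator 0 ≈ 0#)
    denominator₀≉0 eq = 1-t²≉0 (trans (sym (+-congˡ (-‿cong (begin
      (t ^ 2 * exp-q 0 + 0#) * (1# * (1# * ⟦ 0 ⟧! ⁻¹)) + 0#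
        ≈⟨ solve 3 (λ τ e i → (τ :* e :+ con 0) :* (con 1 :* (con 1 :* i)) :+ con 0 :=
                              τ :* e :* (con 1 :* i)) refl (t ^ 2) (exp-q 0) (⟦ 0 ⟧! ⁻¹) ⟩
      t ^ 2 * exp-q 0 * exp-q 0
        ≈⟨ *-cong (*-congˡ exp-q-0) exp-q-0 ⟩
      t ^ 2 * 1# * 1#
        ≈⟨ trans (*-identityʳ _) (*-identityʳ _) ⟩
      t ^ 2 ∎)))) eq)

    quotient : numerator /ₛ denominator ≈ₛ Ŵ↓
    quotient = S.trans
      (S.*-congʳ {denominator ⁻¹ₛ} (S.sym {Ŵ↓ *ₛ denominator} {numerator} Ŵ↓*denominator))
      (S.trans {(Ŵ↓ *ₛ denominator) *ₛ denominator ⁻¹ₛ}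
               (S.*-assoc Ŵ↓ denominator (denominator ⁻¹ₛ))
      (S.trans (S.*-congˡ {Ŵ↓} (⁻¹ₛ-inverseʳ denominator denominator₀≉0))
               (S.*-identityʳ Ŵ↓)))

    permutationSeries : Series
    permutationSeries = 1ₛ +ₛ const (t * (1# + y * t))
      *ₛ ∑≥1 (λ n → ((1# + y * t ^ 2) ^ (n ∸ 1) / (1# - t ^ 2) ^ n)
                      * P⁽inv,lpk,val,des⁾ commutativeRing n q α β γ
                      * (1# / ⟦ n ⟧!))

    permutationSeries≈Ŵ↓ : permutationSeries ≈ₛ Ŵ↓
    permutationSeries≈Ŵ↓ n = trans (+-congˡ (const-* (t * (1# + y * t)) (∑≥1 a) n)) (coefficient n)
      where
      a : ℕ → Carrier
      a n = ((1# + y * t ^ 2) ^ (n ∸ 1) / (1# - t ^ 2) ^ n)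
              * P⁽inv,lpk,val,des⁾ commutativeRing n q α β γ * (1# / ⟦ n ⟧!)

      coefficient : ∀ n → 1ₛ n + t * (1# + y * t) * ∑≥1 a n ≈ Ŵ↓ n
      coefficient zero = begin
        1# + t * (1# + y * t) * 0#  ≈⟨ trans (+-congˡ (zeroʳ _)) (+-identityʳ 1#) ⟩
        1#                          ≈⟨ exp-q-0 ⟨
        exp-q 0                     ≈⟨ trans (*-congʳ (*-identityˡ 1#)) (*-identityˡ _) ⟨
        1# * 1# * exp-q 0           ∎
      coefficient (suc n) = begin
        0# + t * X * (A ^ n * (s ^ suc n) ⁻¹ * Pₙ * exp-q (suc n))
          ≈⟨ +-identityˡ _ ⟩
        t * X * (A ^ n * (s ^ suc n) ⁻¹ * Pₙ * exp-q (suc n))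
          ≈⟨ *-congˡ (*-congʳ (*-congʳ (*-congˡ (^-⁻¹ 1-t²≉0 (suc n))))) ⟩
        t * X * (A ^ n * σ ^ suc n * Pₙ * exp-q (suc n))
          ≈⟨ solve 5 (λ x p r P e → x :* (p :* r :* P :* e) := x :* (p :* r) :* P :* e)
               refl (t * X) (A ^ n) (σ ^ suc n) Pₙ (exp-q (suc n)) ⟩
        t * X * (A ^ n * σ ^ suc n) * Pₙ * exp-q (suc n)
          ≈⟨ *-congʳ (P-closed n) ⟩
        Ŵ↓ (suc n) ∎
        where
        A = 1# + y * t ^ 2
        X = 1# + y * t
        s = 1# - t ^ 2
        Pₙ = P⁽inv,lpk,val,des⁾ commutativeRing (suc n) q α β γ

    theorem : numerator /ₛ denominator ≈ₛ permutationSeries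
    theorem n = trans (quotient n) (sym (permutationSeries≈Ŵ↓ n))

-- Nonvanishing in ℚ(q, y, t)

module ConstantCoefficient (D : DecIntegralDomain c ℓ) where
  open DecIntegralDomain D
  open Polynomial D

  coeff₀-* : ∀ p r → coeff (p *ₚ r) 0 ≈ coeff p 0 * coeff r 0
  coeff₀-* p r = trans (coeff-* p r 0) (+-identityʳ _)

open import Defs

constantTerm : ℤ[q,y,t].Poly → ℤ
constantTerm p = ℤ[q].coeff (ℤ[q,y].coeff (ℤ[q,y,t].coeff p 0) 0) 0

constantTerm-+ : ∀ p r → constantTerm (p ℤ[q,y,t].+ₚ r) ≡ constantTerm p ℤ.+ constantTerm r
constantTerm-+ p r = ≡.trans (ℤ[q,y,t].coeff-+ p r 0 0 0)
  (≡.trans (ℤ[q,y].coeff-+ (ℤ[q,y,t].coeff p 0) (ℤ[q,y,t].coeff r 0) 0 0)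
           (ℤ[q].coeff-+ (ℤ[q,y].coeff (ℤ[q,y,t].coeff p 0) 0)
                         (ℤ[q,y].coeff (ℤ[q,y,t].coeff r 0) 0) 0))

constantTerm-* : ∀ p r → constantTerm (p ℤ[q,y,t].*ₚ r) ≡ constantTerm p ℤ.* constantTerm r
constantTerm-* p r = ≡.trans (ConstantCoefficient.coeff₀-* ℤ[q,y].polyDomain p r 0 0)
  (≡.trans (ConstantCoefficient.coeff₀-* ℤ[q].polyDomain (ℤ[q,y,t].coeff p 0) (ℤ[q,y,t].coeff r 0) 0)
           (ConstantCoefficient.coeff₀-* ℤ-domain
             (ℤ[q,y].coeff (ℤ[q,y,t].coeff p 0) 0) (ℤ[q,y].coeff (ℤ[q,y,t].coeff r 0) 0)))

-- Fractions are not reduced. Denominators with constant term 1 make the constant term of the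
-- numerator compatible with sums and products.
HasConstant : K → ℤ → Set
HasConstant x a = constantTerm (Frac.num x) ≡ a × constantTerm (Frac.den x) ≡ 1ℤ

HasConstant-* : ∀ x z {a b} → HasConstant x a → HasConstant z b → HasConstant (x * z) (a ℤ.* b)
HasConstant-* (p Frac.÷ p′ [ _ ]) (r Frac.÷ r′ [ _ ]) (≡.refl , p′₀) (≡.refl , r′₀) =
    constantTerm-* p r
  , ≡.trans (constantTerm-* p′ r′) (≡.cong₂ ℤ._*_ p′₀ r′₀)

HasConstant-+ : ∀ x z {a b} → HasConstant x a → HasConstant z b → HasConstant (x + z) (a ℤ.+ b)
HasConstant-+ (p Frac.÷ p′ [ _ ]) (r Frac.÷ r′ [ _ ]) (≡.refl , p′₀) (≡.refl , r′₀) =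
    ≡.trans (constantTerm-+ (p ℤ[q,y,t].*ₚ r′) (r ℤ[q,y,t].*ₚ p′))
      (≡.cong₂ ℤ._+_ (scale p r′ r′₀) (scale r p′ p′₀))
  , ≡.trans (constantTerm-* p′ r′) (≡.cong₂ ℤ._*_ p′₀ r′₀)
  where
  scale : ∀ p r → constantTerm r ≡ 1ℤ → constantTerm (p ℤ[q,y,t].*ₚ r) ≡ constantTerm p
  scale p r r₀ = ≡.trans (constantTerm-* p r)
    (≡.trans (≡.cong (constantTerm p ℤ.*_) r₀) (ℤ.*-identityʳ _))

q^[1+n]-constant : ∀ n → HasConstant (q ^ suc n) 0ℤ
q^[1+n]-constant zero    = HasConstant-* q 1# (≡.refl , ≡.refl) (≡.refl , ≡.refl)
q^[1+n]-constant (suc n) = HasConstant-* q (q ^ suc n) (≡.refl , ≡.refl) (q^[1+n]-constant n)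

-- At q = 0 only the summand 1 of 1 + q + ⋯ + qⁿ survives. Since n is arbitrary, induction replaces
-- evaluation.
[1+n]q-constant : ∀ n → HasConstant [ suc n ]q 1ℤ
[1+n]q-constant zero    = HasConstant-+ 0# 1# (≡.refl , ≡.refl) (≡.refl , ≡.refl)
[1+n]q-constant (suc n) = HasConstant-+ [ suc n ]q (q ^ suc n) ([1+n]q-constant n) (q^[1+n]-constant n)

open DecField ℚ⟨q,y,t⟩ using (_≈_; refl)

-- `i`, `j`, `k` are the exponents of q, y, t. For a closed expression the coefficient evaluates to
-- an integer, which settles nonvanishing.
coefficient≢0⇒≉0 : ∀ x i j k →
  ¬ (ℤ[q].coeff (ℤ[q,y].coeff (ℤ[q,y,t].coeff (Frac.num x) k) j) i ≡ 0ℤ) → ¬ (x ≈ 0#)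
coefficient≢0⇒≉0 x i j k c≢0 x≈0 = c≢0 (Frac.num≈0 x x≈0 k j i)

[1+n]q≉0 : ∀ n → ¬ ([ suc n ]q ≈ 0#)
[1+n]q≉0 n = coefficient≢0⇒≉0 [ suc n ]q 0 0 0 λ eq →
  contradiction (≡.trans (≡.sym (proj₁ ([1+n]q-constant n))) eq) λ ()

module Gen = GeneratingFunction ℚ⟨q,y,t⟩ q y t [_]q [_]q!
  (refl {0#}) (λ n → refl {[ suc n ]q}) (refl {1#}) (λ n → refl {[ suc n ]q!}) [1+n]q≉0
  (coefficient≢0⇒≉0 (1# - t ^ 2) 0 0 0 λ ())
  (coefficient≢0⇒≉0 (1# + y * t ^ 2) 0 0 0 λ ())
  -- The constant term is 0 here, so the coefficient of y is inspected instead.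
  (coefficient≢0⇒≉0 (y + t ^ 2) 0 1 0 λ ())
  (coefficient≢0⇒≉0 (1# + y * t) 0 0 0 λ ())
  (coefficient≢0⇒≉0 (y + t) 0 1 0 λ ())

theorem4p16 : (const (1# - t) *ₛ (1ₛ +ₛ const t *ₛ exp-q))
    /ₛ (1ₛ -ₛ const (t ^ 2) *ₛ exp-q *ₛ rescale y Exp-q)
    ≈ₛ
    1ₛ +ₛ const (t * (1# + y * t))
    *ₛ ∑≥1 (λ n → ((1# + y * t ^ 2) ^ (n ∸ 1) / (1# - t ^ 2) ^ n)
    * P n q α β γ
    * (1# / [ n ]q!))
theorem4p16 = Gen.theorem
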